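{- Let $\mathcal{F}\subset\binom{[n]}{k}$ be a $t$-intersecting family. If $\tau_t(\mathcal{F})=t+1$ and $n\geq 2k-t+2$, then $\beta(\mathcal{F})\leq\binom{n-t-3}{k-t-2}$.
   Context: $\binom{[n]}{k}$ denotes the family of all $k$-element subsets of $[n]=\{1,\dots,n\}$. A family is $t$-intersecting if $|F\cap F'|\geq t$ for all members $F,F'$. A set $T\subset[n]$ is a $t$-transversal of $\mathcal{F}$ if $|T\cap F|\geq t$ for all $F\in\mathcal{F}$; $\tau_t(\mathcal{F})$ is the minimum size of a $t$-transversal of $\mathcal{F}$. For distinct $i,j\in[n]$, let $b_{ij}(\mathcal{F})=|\{F\in\mathcal{F}\colon i\in F,\ j\notin F\}|$; the sturdiness is $\beta(\mathcal{F})=\min_{1\leq i\neq j\leq n} b_{ij}(\mathcal{F})$. -}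

module Defs where

open import Data.Nat using (ℕ; _≤_; _+_; _∸_; _<_; _≤?_)
open import Data.Nat.Combinatorics using (_C_)
open import Data.Fin using (Fin)
open import Data.Fin.Subset using (Subset; _∩_; ∣_∣; _∈_; _∉_)
open import Data.Fin.Subset.Properties using (_∈?_)
open import Data.List using (List; length; filter)
open import Data.List.Membership.Propositional renaming (_∈_ to _∈ₗ_)
open import Data.List.Relation.Unary.Unique.Propositional using (Unique)
open import Data.Product using (_×_; Σ; ∃; ∃-syntax)
open import Relation.Nullary using (¬_; yes; no)
open import Relation.Nullary.Decidable using (_×-dec_; ¬?)
open import Relation.Binary.PropositionalEquality using (_≡_)

record Family (n : ℕ) : Set where
  constructor family
  field
    members : List (Subset n)
    distinct : Unique members
open Family public

Uniform : ∀ {n} → ℕ → Family n → Set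
Uniform k 𝓕 = ∀ {F} → F ∈ₗ members 𝓕 → ∣ F ∣ ≡ k

TIntersecting : ∀ {n} → ℕ → Family n → Set
TIntersecting t 𝓕 = ∀ {F G} → F ∈ₗ members 𝓕 → G ∈ₗ members 𝓕 → t ≤ ∣ F ∩ G ∣

IsTTransversal : ∀ {n} → ℕ → Family n → Subset n → Set
IsTTransversal t 𝓕 T = ∀ {F} → F ∈ₗ members 𝓕 → t ≤ ∣ T ∩ F ∣

TauIs : ∀ {n} → ℕ → Family n → ℕ → Set
TauIs t 𝓕 m =
  (∃[ T ] (IsTTransversal t 𝓕 T × ∣ T ∣ ≡ m)) ×
  (∀ T → IsTTransversal t 𝓕 T → m ≤ ∣ T ∣)

b : ∀ {n} → Family n → Fin n → Fin n → ℕ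
b 𝓕 i j = length (filter (λ F → (i ∈? F) ×-dec ¬? (j ∈? F)) (members 𝓕))

-- β(𝓕) ≤ m : the minimum of b_ij over distinct i, j is at most m
SturdinessAtMost : ∀ {n} → Family n → ℕ → Set
SturdinessAtMost 𝓕 m = ∃[ i ] ∃[ j ] (¬ i ≡ j × b 𝓕 i j ≤ m)

-- binomial coefficient C(a - c, b - d) for integer arguments, with the
-- convention that it is 0 when the lower index b - d is negative
-- (the upper index is guaranteed nonnegative where used)
binomSub : ℕ → ℕ → ℕ → ℕ → ℕ
binomSub a c b' d with d ≤? b'
... | yes _ = (a ∸ c) C (b' ∸ d)
... | no  _ = 0

{-# OPTIONS --safe #-}
module Submission where

-- A (t+1)-element t-transversal T has two elements x ≠ y.  A member of the family missing x contains T ∖ {x}, so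
-- b i x, for i ∉ T, is the degree of i in the traces on [n] ∖ T of the members missing x.  For x and y these traces
-- are cross-intersecting families of (k−t)-sets on m = n−t−1 ≥ 2(k−t)+1 points, and it remains to bound the smaller
-- of their two minimum degrees by C(m−2, k−t−2).
--
-- This is a spectral argument (after Huang and Zhao) on integer-valued functions on the Boolean lattice.  On the
-- orthogonal complement of the affine functions the disjointness operator K has norm at most λ = C(m−a−2, a−2),
-- since K is l! times less than an l-fold iterate of the raising operator, whose norm is controlled by the sl₂
-- relations.  For indicators f, g with ⟨f, K g⟩ = 0 this gives a quadratic inequality between the sizes and degrees
-- of the two families, which fails when all degrees exceed C(m−2, a−2).

open import Data.Empty using (⊥; ⊥-elim)
open import Data.Fin using (Fin; zero; suc)
open import Data.Fin.Properties using (any?; _≟_)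
open import Data.Fin.Subset using (Subset; inside; outside; ∣_∣; ∁; ⁅_⁆; _∈_; _∉_; _∩_; _⊆_; Empty; Nonempty)
  renaming (⊥ to ∅)
open import Data.Fin.Subset.Properties
import Data.Integer.Properties as ℤₚ
import Data.Integer.Tactic.RingSolver as ℤRing
open import Data.Nat using (ℕ)
import Data.Nat.Properties as ℕₚ
import Data.Nat.Tactic.RingSolver as ℕRing
open import Data.Nat.Combinatorics
  using (_C_; nCk≡n!/k![n-k]!; k![n∸k]!∣n!; nC1≡n; k>n⇒nCk≡0; nCk+nC[k+1]≡[n+1]C[k+1])
open import Data.Product using (_×_; _,_; proj₁; proj₂; ∃-syntax)
open import Data.Sum using (_⊎_; inj₁; inj₂)
open import Data.Vec using ([]; _∷_; here; there)
open import Function using (_∘_; _⟨_⟩_)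
open import Relation.Binary.PropositionalEquality hiding (J)
open import Relation.Nullary using (¬_; Dec; yes; no; contradiction)

-- Two different points of `T` are needed: members missing the same `x` already share the `t`
-- elements of `T - x` and may be disjoint elsewhere, while a member missing `x` and one missing `y`
-- share only `t - 1` elements of `T`.
--
-- On affine functions `K` is known exactly, so a norm estimate is required only on their orthogonal
-- complement. A pair of equal stars makes every inequality of the argument tight: both sizes are
-- `C₁`, all degrees off the centre are `Δ`, and the projections to the complement vanish. So no
-- step may lose anything, and the contradiction comes from integrality: if all degrees are at least
-- `Δ + 1`, the excess over `Δ` cannot be concentrated in one point, and this costs at least one
-- unit in the sum of the products of the degrees.
--
-- Fractions and square roots are avoided by scaling: the projections are multiplied by a common
-- denominator `c`, and Cauchy-Schwarz appears as nonnegativity of the norm of an integer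
-- combination.

variable
  m n : ℕ

module Cubes where

  open import Algebra.Properties.Semiring.Sum ℤₚ.+-*-semiring using (sum)
  open import Data.Integer as ℤ using (ℤ; +_; -[1+_]; 0ℤ; 1ℤ; Positive; _+_; _*_; -_; _-_; _≤_; +≤+)
  open import Data.Nat as ℕ using (ℕ; zero; suc; _!)
  import Data.Nat.DivMod as ℕ/

  -- Functions on the Boolean lattice: sums, raising, lowering and subset-sum operators

  Cube : ℕ → Set
  Cube m = Subset m → ℤ

  lower upper : Cube (suc m) → Cube m
  lower h S = h (outside ∷ S)
  upper h S = h (inside ∷ S)

  ∑ : Cube m → ℤ
  ∑ {zero}  h = h []
  ∑ {suc m} h = ∑ (lower h) + ∑ (upper h)

  ⟪_,_⟫ : Cube m → Cube m → ℤ
  ⟪ h , k ⟫ = ∑ (λ S → h S * k S)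

  ∑-cong : {h k : Cube m} → (∀ S → h S ≡ k S) → ∑ h ≡ ∑ k
  ∑-cong {zero}  e = e []
  ∑-cong {suc m} e = cong₂ _+_ (∑-cong (e ∘ (outside ∷_))) (∑-cong (e ∘ (inside ∷_)))

  ∑-+ : (h k : Cube m) → ∑ (λ S → h S + k S) ≡ ∑ h + ∑ k
  ∑-+ {zero}  h k = refl
  ∑-+ {suc m} h k = trans (cong₂ _+_ (∑-+ (lower h) (lower k)) (∑-+ (upper h) (upper k))) (interchange (∑ (lower h)) (∑ (lower k)) (∑ (upper h)) (∑ (upper k)))
    where
    interchange : ∀ a b c d → (a + b) + (c + d) ≡ (a + c) + (b + d)
    interchange = ℤRing.solve-∀

  ∑-* : (c : ℤ) (h : Cube m) → ∑ (λ S → c * h S) ≡ c * ∑ h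
  ∑-* {zero}  c h = refl
  ∑-* {suc m} c h = trans (cong₂ _+_ (∑-* c (lower h)) (∑-* c (upper h))) (sym (ℤₚ.*-distribˡ-+ c (∑ (lower h)) (∑ (upper h))))

  ∑-linear : (a b : ℤ) (h k : Cube m) → ∑ (λ S → a * h S + b * k S) ≡ a * ∑ h + b * ∑ k
  ∑-linear a b h k = trans (∑-+ (λ S → a * h S) (λ S → b * k S)) (cong₂ _+_ (∑-* a h) (∑-* b k))

  ∑-zero : {h : Cube m} → (∀ S → h S ≡ 0ℤ) → ∑ h ≡ 0ℤ
  ∑-zero {zero}  z = z []
  ∑-zero {suc m} z = cong₂ _+_ (∑-zero (z ∘ (outside ∷_))) (∑-zero (z ∘ (inside ∷_)))

  ∑-nonneg : {h : Cube m} → (∀ S → 0ℤ ≤ h S) → 0ℤ ≤ ∑ h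
  ∑-nonneg {zero}  p = p []
  ∑-nonneg {suc m} p = ℤₚ.+-mono-≤ (∑-nonneg (p ∘ (outside ∷_))) (∑-nonneg (p ∘ (inside ∷_)))

  ∑-∁ : (h : Cube m) → ∑ (h ∘ ∁) ≡ ∑ h
  ∑-∁ {zero}  h = refl
  ∑-∁ {suc m} h = trans (cong₂ _+_ (∑-∁ (upper h)) (∑-∁ (lower h))) (ℤₚ.+-comm (∑ (upper h)) (∑ (lower h)))

  ⟪⟫-comm : (h k : Cube m) → ⟪ h , k ⟫ ≡ ⟪ k , h ⟫
  ⟪⟫-comm h k = ∑-cong (λ S → ℤₚ.*-comm (h S) (k S))

  ⟪⟫-+ʳ : (h k l : Cube m) → ⟪ h , (λ S → k S + l S) ⟫ ≡ ⟪ h , k ⟫ + ⟪ h , l ⟫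
  ⟪⟫-+ʳ h k l = trans (∑-cong (λ S → ℤₚ.*-distribˡ-+ (h S) (k S) (l S))) (∑-+ (λ S → h S * k S) (λ S → h S * l S))

  ⟪⟫-+ˡ : (k l h : Cube m) → ⟪ (λ S → k S + l S) , h ⟫ ≡ ⟪ k , h ⟫ + ⟪ l , h ⟫
  ⟪⟫-+ˡ k l h = trans (∑-cong (λ S → ℤₚ.*-distribʳ-+ (h S) (k S) (l S))) (∑-+ (λ S → k S * h S) (λ S → l S * h S))

  ⟪⟫-linearʳ : (h : Cube m) (a b : ℤ) (k l : Cube m) →
    ⟪ h , (λ S → a * k S + b * l S) ⟫ ≡ a * ⟪ h , k ⟫ + b * ⟪ h , l ⟫
  ⟪⟫-linearʳ h a b k l = trans (∑-cong (λ S → lem (h S) a b (k S) (l S))) (∑-linear a b (λ S → h S * k S) (λ S → h S * l S))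
    where
    lem : ∀ h a b k l → h * (a * k + b * l) ≡ a * (h * k) + b * (h * l)
    lem = ℤRing.solve-∀

  ⟪⟫-linearˡ : (a b : ℤ) (k l h : Cube m) →
    ⟪ (λ S → a * k S + b * l S) , h ⟫ ≡ a * ⟪ k , h ⟫ + b * ⟪ l , h ⟫
  ⟪⟫-linearˡ a b k l h = trans (⟪⟫-comm _ h) (trans (⟪⟫-linearʳ h a b k l)
    (cong₂ (λ x y → a * x + b * y) (⟪⟫-comm h k) (⟪⟫-comm h l)))

  -- The raising and lowering operators of the Boolean lattice: sums over the subsets S ∖ {i} and the supersets S ∪ {i}.
  U D : Cube m → Cube m
  U h []            = 0ℤ
  U h (outside ∷ S) = U (lower h) S
  U h (inside ∷ S)  = U (upper h) S + h (outside ∷ S)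

  D h []            = 0ℤ
  D h (outside ∷ S) = D (lower h) S + h (inside ∷ S)
  D h (inside ∷ S)  = D (upper h) S

  U-cong : {h k : Cube m} → (∀ S → h S ≡ k S) → ∀ S → U h S ≡ U k S
  U-cong e []            = refl
  U-cong e (outside ∷ S) = U-cong (e ∘ (outside ∷_)) S
  U-cong e (inside ∷ S)  = cong₂ _+_ (U-cong (e ∘ (inside ∷_)) S) (e (outside ∷ S))

  D-cong : {h k : Cube m} → (∀ S → h S ≡ k S) → ∀ S → D h S ≡ D k S
  D-cong e []            = refl
  D-cong e (outside ∷ S) = cong₂ _+_ (D-cong (e ∘ (outside ∷_)) S) (e (inside ∷ S))
  D-cong e (inside ∷ S)  = D-cong (e ∘ (inside ∷_)) S

  U-zero : {h : Cube m} → (∀ S → h S ≡ 0ℤ) → ∀ S → U h S ≡ 0ℤ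
  U-zero z []            = refl
  U-zero z (outside ∷ S) = U-zero (z ∘ (outside ∷_)) S
  U-zero z (inside ∷ S)  = cong₂ _+_ (U-zero (z ∘ (inside ∷_)) S) (z (outside ∷ S))

  U-+ : (h k : Cube m) → ∀ S → U (λ T → h T + k T) S ≡ U h S + U k S
  U-+ h k []            = refl
  U-+ h k (outside ∷ S) = U-+ (lower h) (lower k) S
  U-+ h k (inside ∷ S)  = trans (cong (_+ (h (outside ∷ S) + k (outside ∷ S))) (U-+ (upper h) (upper k) S))
    (lem (U (upper h) S) (U (upper k) S) (h (outside ∷ S)) (k (outside ∷ S)))
    where
    lem : ∀ a b c d → (a + b) + (c + d) ≡ (a + c) + (b + d)
    lem = ℤRing.solve-∀

  D-+ : (h k : Cube m) → ∀ S → D (λ T → h T + k T) S ≡ D h S + D k S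
  D-+ h k []            = refl
  D-+ h k (inside ∷ S)  = D-+ (upper h) (upper k) S
  D-+ h k (outside ∷ S) = trans (cong (_+ (h (inside ∷ S) + k (inside ∷ S))) (D-+ (lower h) (lower k) S))
    (lem (D (lower h) S) (D (lower k) S) (h (inside ∷ S)) (k (inside ∷ S)))
    where
    lem : ∀ a b c d → (a + b) + (c + d) ≡ (a + c) + (b + d)
    lem = ℤRing.solve-∀

  U-* : (c : ℤ) (h : Cube m) → ∀ S → U (λ T → c * h T) S ≡ c * U h S
  U-* c h []            = sym (ℤₚ.*-zeroʳ c)
  U-* c h (outside ∷ S) = U-* c (lower h) S
  U-* c h (inside ∷ S)  = trans (cong (_+ c * h (outside ∷ S)) (U-* c (upper h) S)) (sym (ℤₚ.*-distribˡ-+ c (U (upper h) S) (h (outside ∷ S))))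

  D-* : (c : ℤ) (h : Cube m) → ∀ S → D (λ T → c * h T) S ≡ c * D h S
  D-* c h []            = sym (ℤₚ.*-zeroʳ c)
  D-* c h (inside ∷ S)  = D-* c (upper h) S
  D-* c h (outside ∷ S) = trans (cong (_+ c * h (inside ∷ S)) (D-* c (lower h) S)) (sym (ℤₚ.*-distribˡ-+ c (D (lower h) S) (h (inside ∷ S))))

  U-adjoint : (h k : Cube m) → ⟪ U h , k ⟫ ≡ ⟪ h , D k ⟫
  U-adjoint {zero}  h k = sym (ℤₚ.*-zeroʳ (h []))
  U-adjoint {suc m} h k = begin
    ⟪ U (lower h) , lower k ⟫ + ∑ (λ S → (U (upper h) S + lower h S) * upper k S)
      ≡⟨ cong (λ x → ⟪ U (lower h) , lower k ⟫ + x)(⟪⟫-+ˡ (U (upper h)) (lower h) (upper k)) ⟩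
    ⟪ U (lower h) , lower k ⟫ + (⟪ U (upper h) , upper k ⟫ + ⟪ lower h , upper k ⟫)
      ≡⟨ cong₂ (λ x y → x + (y + ⟪ lower h , upper k ⟫)) (U-adjoint (lower h) (lower k)) (U-adjoint (upper h) (upper k)) ⟩
    ⟪ lower h , D (lower k) ⟫ + (⟪ upper h , D (upper k) ⟫ + ⟪ lower h , upper k ⟫)
      ≡⟨ lem ⟪ lower h , D (lower k) ⟫ ⟪ upper h , D (upper k) ⟫ ⟪ lower h , upper k ⟫ ⟩
    (⟪ lower h , D (lower k) ⟫ + ⟪ lower h , upper k ⟫) + ⟪ upper h , D (upper k) ⟫
      ≡⟨ cong (_+ ⟪ upper h , D (upper k) ⟫)(sym (⟪⟫-+ʳ (lower h) (D (lower k)) (upper k))) ⟩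
    ∑ (λ S → lower h S * (D (lower k) S + upper k S)) + ⟪ upper h , D (upper k) ⟫ ∎
    where
    open ≡-Reasoning
    lem : ∀ a b c → a + (b + c) ≡ (a + c) + b
    lem = ℤRing.solve-∀

  size : Cube m
  size S = + ∣ S ∣

  -- The sl₂ relation [D, U] = m − 2|S|, without subtraction.
  commutator : (h : Cube m) → ∀ S → D (U h) S + (size S + size S) * h S ≡ U (D h) S + + m * h S
  commutator h [] = refl
  commutator {suc m} h (outside ∷ S) = begin
    (D (U h₀) S + (U h₁ S + h₀ S)) + (s + s) * h₀ S  ≡⟨ lem₁ (D (U h₀) S) (U h₁ S) (h₀ S) s ⟩
    (D (U h₀) S + (s + s) * h₀ S) + (U h₁ S + h₀ S)  ≡⟨ cong (_+ (U h₁ S + h₀ S)) (commutator h₀ S) ⟩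
    (U (D h₀) S + + m * h₀ S) + (U h₁ S + h₀ S)      ≡⟨ lem₂ (U (D h₀) S) (U h₁ S) (h₀ S) (+ m) ⟩
    (U (D h₀) S + U h₁ S) + (1ℤ + + m) * h₀ S        ≡⟨ cong (_+ (1ℤ + + m) * h₀ S) (sym (U-+ (D h₀) h₁ S)) ⟩
    U (λ T → D h₀ T + h₁ T) S + (1ℤ + + m) * h₀ S    ∎
    where
    open ≡-Reasoning
    h₀ = lower h
    h₁ = upper h
    s  = size S
    lem₁ : ∀ a b c s → (a + (b + c)) + (s + s) * c ≡ (a + (s + s) * c) + (b + c)
    lem₁ = ℤRing.solve-∀
    lem₂ : ∀ a b c m → (a + m * c) + (b + c) ≡ (a + b) + (1ℤ + m) * c
    lem₂ = ℤRing.solve-∀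
  commutator {suc m} h (inside ∷ S) = begin
    D (λ T → U h₁ T + h₀ T) S + ((1ℤ + s) + (1ℤ + s)) * h₁ S
      ≡⟨ cong (_+ ((1ℤ + s) + (1ℤ + s)) * h₁ S) (D-+ (U h₁) h₀ S) ⟩
    (D (U h₁) S + D h₀ S) + ((1ℤ + s) + (1ℤ + s)) * h₁ S
      ≡⟨ lem₁ (D (U h₁) S) (D h₀ S) (h₁ S) s ⟩
    (D (U h₁) S + (s + s) * h₁ S) + (D h₀ S + h₁ S + h₁ S)
      ≡⟨ cong (_+ (D h₀ S + h₁ S + h₁ S)) (commutator h₁ S) ⟩
    (U (D h₁) S + + m * h₁ S) + (D h₀ S + h₁ S + h₁ S)
      ≡⟨ lem₂ (U (D h₁) S) (D h₀ S) (h₁ S) (+ m) ⟩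
    (U (D h₁) S + (D h₀ S + h₁ S)) + (1ℤ + + m) * h₁ S ∎
    where
    open ≡-Reasoning
    h₀ = lower h
    h₁ = upper h
    s  = size S
    lem₁ : ∀ a b c s → (a + b) + ((1ℤ + s) + (1ℤ + s)) * c ≡ (a + (s + s) * c) + (b + c + c)
    lem₁ = ℤRing.solve-∀
    lem₂ : ∀ a b c m → (a + m * c) + (b + c + c) ≡ (a + (b + c)) + (1ℤ + m) * c
    lem₂ = ℤRing.solve-∀

  -- Sum over all subsets of S; so K h S is the sum over all sets disjoint from S.
  ζ : Cube m → Cube m
  ζ h []            = h []
  ζ h (outside ∷ S) = ζ (lower h) S
  ζ h (inside ∷ S)  = ζ (lower h) S + ζ (upper h) S

  K : Cube m → Cube m
  K h S = ζ h (∁ S)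

  ζ-cong : {h k : Cube m} → (∀ S → h S ≡ k S) → ∀ S → ζ h S ≡ ζ k S
  ζ-cong e []            = e []
  ζ-cong e (outside ∷ S) = ζ-cong (e ∘ (outside ∷_)) S
  ζ-cong e (inside ∷ S)  = cong₂ _+_ (ζ-cong (e ∘ (outside ∷_)) S) (ζ-cong (e ∘ (inside ∷_)) S)

  ζ-linear : (a b : ℤ) (h k : Cube m) → ∀ S → ζ (λ T → a * h T + b * k T) S ≡ a * ζ h S + b * ζ k S
  ζ-linear a b h k []            = refl
  ζ-linear a b h k (outside ∷ S) = ζ-linear a b (lower h) (lower k) S
  ζ-linear a b h k (inside ∷ S)  = trans (cong₂ _+_ (ζ-linear a b (lower h) (lower k) S) (ζ-linear a b (upper h) (upper k) S))
    (lem a b (ζ (lower h) S) (ζ (lower k) S) (ζ (upper h) S) (ζ (upper k) S))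
    where
    lem : ∀ a b x y z w → (a * x + b * y) + (a * z + b * w) ≡ a * (x + z) + b * (y + w)
    lem = ℤRing.solve-∀

  K-selfAdjoint : (h k : Cube m) → ⟪ h , K k ⟫ ≡ ⟪ K h , k ⟫
  K-selfAdjoint {zero}  h k = refl
  K-selfAdjoint {suc m} h k = begin
    ∑ (λ S → lower h S * (K (lower k) S + K (upper k) S)) + ⟪ upper h , K (lower k) ⟫
      ≡⟨ cong (_+ ⟪ upper h , K (lower k) ⟫) (⟪⟫-+ʳ (lower h) (K (lower k)) (K (upper k))) ⟩
    (⟪ lower h , K (lower k) ⟫ + ⟪ lower h , K (upper k) ⟫) + ⟪ upper h , K (lower k) ⟫
      ≡⟨ cong₂ _+_ (cong₂ _+_ (K-selfAdjoint (lower h) (lower k)) (K-selfAdjoint (lower h) (upper k))) (K-selfAdjoint (upper h) (lower k)) ⟩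
    (⟪ K (lower h) , lower k ⟫ + ⟪ K (lower h) , upper k ⟫) + ⟪ K (upper h) , lower k ⟫
      ≡⟨ lem ⟪ K (lower h) , lower k ⟫ ⟪ K (lower h) , upper k ⟫ ⟪ K (upper h) , lower k ⟫ ⟩
    (⟪ K (lower h) , lower k ⟫ + ⟪ K (upper h) , lower k ⟫) + ⟪ K (lower h) , upper k ⟫
      ≡⟨ cong (_+ ⟪ K (lower h) , upper k ⟫) (sym (⟪⟫-+ˡ (K (lower h)) (K (upper h)) (lower k))) ⟩
    ∑ (λ S → (K (lower h) S + K (upper h) S) * lower k S) + ⟪ K (lower h) , upper k ⟫ ∎
    where
    open ≡-Reasoning
    lem : ∀ a b c → (a + b) + c ≡ (a + c) + b
    lem = ℤRing.solve-∀

  -- A subset `B` of `S` survives the removal of exactly those |S| - |B| elements of `S` that lie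
  -- outside `B`.
  U-ζ : (h : Cube m) → ∀ S → U (ζ h) S + ζ (λ T → size T * h T) S ≡ size S * ζ h S
  U-ζ h [] = refl
  U-ζ h (outside ∷ S) = U-ζ (lower h) S
  U-ζ {suc m} h (inside ∷ S) = begin
    (U (λ T → ζ h₀ T + ζ h₁ T) S + ζ h₀ S) + (ζ (λ T → size T * h₀ T) S + ζ (λ T → (1ℤ + size T) * h₁ T) S)
      ≡⟨ cong₂ (λ x y → (x + ζ h₀ S) + (ζ (λ T → size T * h₀ T) S + y)) (U-+ (ζ h₀) (ζ h₁) S)
           (trans (ζ-cong (λ T → lem₀ (size T) (h₁ T)) S) (ζ-linear 1ℤ 1ℤ h₁ (λ T → size T * h₁ T) S)) ⟩
    ((U (ζ h₀) S + U (ζ h₁) S) + ζ h₀ S) + (ζ (λ T → size T * h₀ T) S + (1ℤ * ζ h₁ S + 1ℤ * ζ (λ T → size T * h₁ T) S))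
      ≡⟨ lem₁ (U (ζ h₀) S) (U (ζ h₁) S) (ζ h₀ S) (ζ (λ T → size T * h₀ T) S) (ζ h₁ S) (ζ (λ T → size T * h₁ T) S) ⟩
    (U (ζ h₀) S + ζ (λ T → size T * h₀ T) S) + (U (ζ h₁) S + ζ (λ T → size T * h₁ T) S) + (ζ h₀ S + ζ h₁ S)
      ≡⟨ cong₂ (λ x y → x + y + (ζ h₀ S + ζ h₁ S)) (U-ζ h₀ S) (U-ζ h₁ S) ⟩
    size S * ζ h₀ S + size S * ζ h₁ S + (ζ h₀ S + ζ h₁ S)
      ≡⟨ lem₂ (size S) (ζ h₀ S) (ζ h₁ S) ⟩
    (1ℤ + size S) * (ζ h₀ S + ζ h₁ S) ∎
    where
    open ≡-Reasoning
    h₀ = lower h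
    h₁ = upper h
    lem₀ : ∀ s x → (1ℤ + s) * x ≡ 1ℤ * x + 1ℤ * (s * x)
    lem₀ = ℤRing.solve-∀
    lem₁ : ∀ a b c d e f → ((a + b) + c) + (d + (1ℤ * e + 1ℤ * f)) ≡ (a + d) + (b + f) + (c + e)
    lem₁ = ℤRing.solve-∀
    lem₂ : ∀ s a b → s * a + s * b + (a + b) ≡ (1ℤ + s) * (a + b)
    lem₂ = ℤRing.solve-∀

  ζ-vanish : (h : Cube m) (S : Subset m) → (∀ B → ∣ B ∣ ℕ.≤ ∣ S ∣ → h B ≡ 0ℤ) → ζ h S ≡ 0ℤ
  ζ-vanish h [] z = z [] ℕ.z≤n
  ζ-vanish h (outside ∷ S) z = ζ-vanish (lower h) S (λ B → z (outside ∷ B))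
  ζ-vanish h (inside ∷ S) z = cong₂ _+_
    (ζ-vanish (lower h) S (λ B p → z (outside ∷ B) (ℕₚ.m≤n⇒m≤1+n p)))
    (ζ-vanish (upper h) S (λ B p → z (inside ∷ B) (ℕ.s≤s p)))

  ζ-minimal : (h : Cube m) (S : Subset m) → (∀ B → ∣ B ∣ ℕ.< ∣ S ∣ → h B ≡ 0ℤ) → ζ h S ≡ h S
  ζ-minimal h [] z = refl
  ζ-minimal h (outside ∷ S) z = ζ-minimal (lower h) S (λ B → z (outside ∷ B))
  ζ-minimal h (inside ∷ S) z = trans (cong₂ _+_
    (ζ-vanish (lower h) S (λ B p → z (outside ∷ B) (ℕ.s≤s p)))
    (ζ-minimal (upper h) S (λ B p → z (inside ∷ B) (ℕ.s≤s p)))) (ℤₚ.+-identityˡ _)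

  lev : ℕ → Cube m
  lev r       (outside ∷ S) = lev r S
  lev zero    []            = 1ℤ
  lev (suc r) []            = 0ℤ
  lev zero    (inside ∷ S)  = 0ℤ
  lev (suc r) (inside ∷ S)  = lev r S

  lev₀-U : (h : Cube m) → ∀ S → lev zero S * U h S ≡ 0ℤ
  lev₀-U h []            = refl
  lev₀-U h (outside ∷ S) = lev₀-U (lower h) S
  lev₀-U h (inside ∷ S)  = ℤₚ.*-zeroˡ (U h (inside ∷ S))

  U-lev : (r : ℕ) (h : Cube m) → ∀ S → U (λ T → lev r T * h T) S ≡ lev (suc r) S * U h S
  U-lev r h [] = refl
  U-lev r h (outside ∷ S) = U-lev r (lower h) S
  U-lev zero h (inside ∷ S) = trans (cong (_+ lev zero S * lower h S) (U-zero (λ T → ℤₚ.*-zeroˡ (upper h T)) S))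
    (trans (cong (_+ lev zero S * lower h S) (sym (lev₀-U (upper h) S))) (sym (ℤₚ.*-distribˡ-+ (lev zero S) (U (upper h) S) (lower h S))))
  U-lev (suc r) h (inside ∷ S) = trans (cong (_+ lev (suc r) S * lower h S) (U-lev r (upper h) S)) (sym (ℤₚ.*-distribˡ-+ (lev (suc r) S) (U (upper h) S) (lower h S)))

  -- Linear functions, levels, and functions orthogonal to the affine ones

  lin : (Fin m → ℤ) → Cube m
  lin γ []            = 0ℤ
  lin γ (outside ∷ S) = lin (γ ∘ suc) S
  lin γ (inside ∷ S)  = γ zero + lin (γ ∘ suc) S

  U-const : (c : ℤ) (S : Subset m) → U (λ _ → c) S ≡ size S * c
  U-const c []            = refl
  U-const c (outside ∷ S) = U-const c S
  U-const c (inside ∷ S)  = trans (cong (_+ c) (U-const c S)) (lem (size S) c)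
    where
    lem : ∀ s c → s * c + c ≡ (1ℤ + s) * c
    lem = ℤRing.solve-∀

  D-const : (c : ℤ) (S : Subset m) → D (λ _ → c) S + size S * c ≡ + m * c
  D-const c []            = refl
  D-const {suc m} c (outside ∷ S) = trans (lem (D (λ _ → c) S) (size S) c) (trans (cong (_+ c) (D-const c S)) (lem′ (+ m) c))
    where
    lem : ∀ d s c → d + c + s * c ≡ (d + s * c) + c
    lem = ℤRing.solve-∀
    lem′ : ∀ m c → m * c + c ≡ (1ℤ + m) * c
    lem′ = ℤRing.solve-∀
  D-const {suc m} c (inside ∷ S)  = trans (lem (D (λ _ → c) S) (size S) c) (trans (cong (_+ c) (D-const c S)) (lem′ (+ m) c))
    where
    lem : ∀ d s c → d + (1ℤ + s) * c ≡ (d + s * c) + c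
    lem = ℤRing.solve-∀
    lem′ : ∀ m c → m * c + c ≡ (1ℤ + m) * c
    lem′ = ℤRing.solve-∀

  U-lin : (γ : Fin m → ℤ) (S : Subset m) → U (lin γ) S + lin γ S ≡ size S * lin γ S
  U-lin γ []            = refl
  U-lin γ (outside ∷ S) = U-lin (γ ∘ suc) S
  U-lin γ (inside ∷ S)  = begin
    (U (λ T → γ zero + lin γ′ T) S + lin γ′ S) + (γ zero + lin γ′ S)
      ≡⟨ cong (λ x → (x + lin γ′ S) + (γ zero + lin γ′ S))
           (trans (U-+ (λ _ → γ zero) (lin γ′) S) (cong (_+ U (lin γ′) S) (U-const (γ zero) S))) ⟩
    ((size S * γ zero + U (lin γ′) S) + lin γ′ S) + (γ zero + lin γ′ S)
      ≡⟨ lem₁ (size S) (γ zero) (U (lin γ′) S) (lin γ′ S) ⟩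
    (U (lin γ′) S + lin γ′ S) + (size S * γ zero + (γ zero + lin γ′ S))
      ≡⟨ cong (_+ (size S * γ zero + (γ zero + lin γ′ S))) (U-lin γ′ S) ⟩
    size S * lin γ′ S + (size S * γ zero + (γ zero + lin γ′ S))
      ≡⟨ lem₂ (size S) (γ zero) (lin γ′ S) ⟩
    (1ℤ + size S) * (γ zero + lin γ′ S) ∎
    where
    open ≡-Reasoning
    γ′ = γ ∘ suc
    lem₁ : ∀ s g u l → ((s * g + u) + l) + (g + l) ≡ (u + l) + (s * g + (g + l))
    lem₁ = ℤRing.solve-∀
    lem₂ : ∀ s g l → s * l + (s * g + (g + l)) ≡ (1ℤ + s) * (g + l)
    lem₂ = ℤRing.solve-∀

  -- An element `i` outside `S` contributes `lin γ S + γ i`, and the values of `γ` outside `S` add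
  -- up to `sum γ - lin γ S`. At fixed |S| the result is affine, as `U-centered` requires.
  D-lin : (γ : Fin m → ℤ) (S : Subset m) → D (lin γ) S + (1ℤ + size S) * lin γ S ≡ + m * lin γ S + sum γ
  D-lin γ []            = refl
  D-lin {suc m} γ (outside ∷ S) = begin
    (D (lin γ′) S + (γ zero + lin γ′ S)) + (1ℤ + size S) * lin γ′ S
      ≡⟨ lem₁ (D (lin γ′) S) (γ zero) (size S) (lin γ′ S) ⟩
    (D (lin γ′) S + (1ℤ + size S) * lin γ′ S) + (γ zero + lin γ′ S)
      ≡⟨ cong (_+ (γ zero + lin γ′ S)) (D-lin γ′ S) ⟩
    (+ m * lin γ′ S + sum γ′) + (γ zero + lin γ′ S)
      ≡⟨ lem₂ (+ m) (lin γ′ S) (sum γ′) (γ zero) ⟩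
    (1ℤ + + m) * lin γ′ S + (γ zero + sum γ′) ∎
    where
    open ≡-Reasoning
    γ′ = γ ∘ suc
    lem₁ : ∀ d g s l → (d + (g + l)) + (1ℤ + s) * l ≡ (d + (1ℤ + s) * l) + (g + l)
    lem₁ = ℤRing.solve-∀
    lem₂ : ∀ m l t g → (m * l + t) + (g + l) ≡ (1ℤ + m) * l + (g + t)
    lem₂ = ℤRing.solve-∀
  D-lin {suc m} γ (inside ∷ S)  = begin
    D (λ T → γ zero + lin γ′ T) S + (1ℤ + (1ℤ + size S)) * (γ zero + lin γ′ S)
      ≡⟨ cong (_+ (1ℤ + (1ℤ + size S)) * (γ zero + lin γ′ S)) (D-+ (λ _ → γ zero) (lin γ′) S) ⟩
    (D (λ _ → γ zero) S + D (lin γ′) S) + (1ℤ + (1ℤ + size S)) * (γ zero + lin γ′ S)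
      ≡⟨ lem₁ (D (λ _ → γ zero) S) (D (lin γ′) S) (γ zero) (size S) (lin γ′ S) ⟩
    (D (λ _ → γ zero) S + size S * γ zero) + (D (lin γ′) S + (1ℤ + size S) * lin γ′ S) + (γ zero + γ zero + lin γ′ S)
      ≡⟨ cong₂ (λ x y → x + y + (γ zero + γ zero + lin γ′ S)) (D-const (γ zero) S) (D-lin γ′ S) ⟩
    + m * γ zero + (+ m * lin γ′ S + sum γ′) + (γ zero + γ zero + lin γ′ S)
      ≡⟨ lem₂ (+ m) (lin γ′ S) (sum γ′) (γ zero) ⟩
    (1ℤ + + m) * (γ zero + lin γ′ S) + (γ zero + sum γ′) ∎
    where
    open ≡-Reasoning
    γ′ = γ ∘ suc
    lem₁ : ∀ c d g s l → (c + d) + (1ℤ + (1ℤ + s)) * (g + l) ≡ (c + s * g) + (d + (1ℤ + s) * l) + (g + g + l)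
    lem₁ = ℤRing.solve-∀
    lem₂ : ∀ m l t g → m * g + (m * l + t) + (g + g + l) ≡ (1ℤ + m) * (g + l) + (g + t)
    lem₂ = ℤRing.solve-∀

  -- "h is supported on the r-element sets", in a form that is linear in h.
  IsLevel : ℤ → Cube m → Set
  IsLevel r h = ∀ S → size S * h S ≡ r * h S

  U-size : (h : Cube m) (S : Subset m) → U (λ T → size T * h T) S + U h S ≡ size S * U h S
  U-size h []            = refl
  U-size h (outside ∷ S) = U-size (lower h) S
  U-size h (inside ∷ S)  = begin
    (U (λ T → (1ℤ + size T) * h₁ T) S + size S * h₀) + (U h₁ S + h₀)
      ≡⟨ cong (λ x → (x + size S * h₀) + (U h₁ S + h₀))
           (trans (U-cong (λ T → lem₀ (size T) (h₁ T)) S) (U-+ h₁ (λ T → size T * h₁ T) S)) ⟩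
    ((U h₁ S + U (λ T → size T * h₁ T) S) + size S * h₀) + (U h₁ S + h₀)
      ≡⟨ lem₁ (U h₁ S) (U (λ T → size T * h₁ T) S) (size S) h₀ ⟩
    (U (λ T → size T * h₁ T) S + U h₁ S) + (size S * h₀ + (U h₁ S + h₀))
      ≡⟨ cong (_+ (size S * h₀ + (U h₁ S + h₀))) (U-size h₁ S) ⟩
    size S * U h₁ S + (size S * h₀ + (U h₁ S + h₀))
      ≡⟨ lem₂ (size S) (U h₁ S) h₀ ⟩
    (1ℤ + size S) * (U h₁ S + h₀) ∎
    where
    open ≡-Reasoning
    h₁ = upper h
    h₀ = lower h S
    lem₀ : ∀ s x → (1ℤ + s) * x ≡ x + s * x
    lem₀ = ℤRing.solve-∀
    lem₁ : ∀ a b s h → ((a + b) + s * h) + (a + h) ≡ (b + a) + (s * h + (a + h))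
    lem₁ = ℤRing.solve-∀
    lem₂ : ∀ s a h → s * a + (s * h + (a + h)) ≡ (1ℤ + s) * (a + h)
    lem₂ = ℤRing.solve-∀

  D-size : (h : Cube m) (S : Subset m) → D (λ T → size T * h T) S ≡ (1ℤ + size S) * D h S
  D-size h []            = refl
  D-size h (outside ∷ S) = trans (cong (_+ (1ℤ + size S) * upper h S) (D-size (lower h) S))
    (sym (ℤₚ.*-distribˡ-+ (1ℤ + size S) (D (lower h) S) (upper h S)))
  D-size h (inside ∷ S)  = begin
    D (λ T → (1ℤ + size T) * h₁ T) S
      ≡⟨ trans (D-cong (λ T → lem₀ (size T) (h₁ T)) S) (D-+ h₁ (λ T → size T * h₁ T) S) ⟩
    D h₁ S + D (λ T → size T * h₁ T) S
      ≡⟨ cong (λ x → D h₁ S + x) (D-size h₁ S) ⟩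
    D h₁ S + (1ℤ + size S) * D h₁ S
      ≡⟨ lem₁ (size S) (D h₁ S) ⟩
    (1ℤ + (1ℤ + size S)) * D h₁ S ∎
    where
    open ≡-Reasoning
    h₁ = upper h
    lem₀ : ∀ s x → (1ℤ + s) * x ≡ x + s * x
    lem₀ = ℤRing.solve-∀
    lem₁ : ∀ s a → a + (1ℤ + s) * a ≡ (1ℤ + (1ℤ + s)) * a
    lem₁ = ℤRing.solve-∀

  U-level : (r : ℤ) (h : Cube m) → IsLevel r h → IsLevel (1ℤ + r) (U h)
  U-level r h l S = trans (sym (U-size h S)) (trans
    (cong (_+ U h S) (trans (U-cong l S) (U-* r h S))) (lem r (U h S)))
    where
    lem : ∀ r x → r * x + x ≡ (1ℤ + r) * x
    lem = ℤRing.solve-∀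

  D-level : (r : ℤ) (h : Cube m) → IsLevel (1ℤ + r) h → IsLevel r (D h)
  D-level r h l S = lem (size S) r (D h S)
    (trans (sym (D-size h S)) (trans (D-cong l S) (D-* (1ℤ + r) h S)))
    where
    sub : ∀ s x → (1ℤ + s) * x - x ≡ s * x
    sub = ℤRing.solve-∀
    lem : ∀ s r x → (1ℤ + s) * x ≡ (1ℤ + r) * x → s * x ≡ r * x
    lem s r x e = trans (sym (sub s x)) (trans (cong (_- x) e) (sub r x))

  -- Orthogonality to the eigenspaces of the Johnson scheme of degree at most one.
  record Centered (h : Cube m) : Set where
    constructor centered
    field
      ∑≡0  : ∑ h ≡ 0ℤ
      lin⊥ : ∀ γ → ⟪ h , lin γ ⟫ ≡ 0ℤ
  open Centered

  ∑≡⟪⟫ : (h : Cube m) → ∑ h ≡ ⟪ h , (λ _ → 1ℤ) ⟫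
  ∑≡⟪⟫ h = ∑-cong (λ S → sym (ℤₚ.*-identityʳ (h S)))

  -- Move `U` across the inner product: on the support of `h` all sets have size `r`, and there `D`
  -- sends constants to constants and linear functions to affine ones, all orthogonal to `h`.
  U-centered : (r : ℤ) (h : Cube m) → IsLevel r h → Centered h → Centered (U h)
  U-centered {m} r h l c = centered
    (trans (∑≡⟪⟫ (U h)) (trans (U-adjoint h (λ _ → 1ℤ))
      (trans (∑-cong pt₁) (trans (∑-* (+ m - r) h) (trans (cong (λ x → (+ m - r) * x) (∑≡0 c)) (ℤₚ.*-zeroʳ (+ m - r)))))))
    λ γ → trans (U-adjoint h (lin γ)) (trans (∑-cong (pt₂ γ))
      (trans (∑-linear (+ m - 1ℤ - r) (sum γ) (λ S → h S * lin γ S) h)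
      (trans (cong₂ (λ x y → (+ m - 1ℤ - r) * x + sum γ * y) (lin⊥ c γ) (∑≡0 c)) (zero-comb (+ m - 1ℤ - r) (sum γ)))))
    where
    zero-comb : ∀ a b → a * 0ℤ + b * 0ℤ ≡ 0ℤ
    zero-comb = ℤRing.solve-∀
    id₁ : ∀ h d s → h * d ≡ h * (d + s * 1ℤ) - s * h
    id₁ = ℤRing.solve-∀
    id₁′ : ∀ h m r → h * (m * 1ℤ) - r * h ≡ (m - r) * h
    id₁′ = ℤRing.solve-∀
    pt₁ : ∀ S → h S * D (λ _ → 1ℤ) S ≡ (+ m - r) * h S
    pt₁ S = trans (id₁ (h S) (D (λ _ → 1ℤ) S) (size S))
      (trans (cong₂ (λ x y → h S * x - y) (D-const 1ℤ S) (l S)) (id₁′ (h S) (+ m) r))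
    id₂ : ∀ h d s l → h * d ≡ h * (d + (1ℤ + s) * l) - h * l - (s * h) * l
    id₂ = ℤRing.solve-∀
    id₂′ : ∀ h m r l t → h * (m * l + t) - h * l - (r * h) * l ≡ (m - 1ℤ - r) * (h * l) + t * h
    id₂′ = ℤRing.solve-∀
    pt₂ : ∀ γ S → h S * D (lin γ) S ≡ (+ m - 1ℤ - r) * (h S * lin γ S) + sum γ * h S
    pt₂ γ S = trans (id₂ (h S) (D (lin γ) S) (size S) (lin γ S))
      (trans (cong₂ (λ x y → h S * x - h S * lin γ S - y * lin γ S) (D-lin γ S) (l S)) (id₂′ (h S) (+ m) r (lin γ S) (sum γ)))

  D-adjoint : (h k : Cube m) → ⟪ D h , k ⟫ ≡ ⟪ h , U k ⟫
  D-adjoint h k = trans (⟪⟫-comm (D h) k) (trans (sym (U-adjoint k h)) (⟪⟫-comm (U k) h))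

  D-centered : (r : ℤ) (h : Cube m) → IsLevel r h → Centered h → Centered (D h)
  D-centered {m} r h l c = centered
    (trans (∑≡⟪⟫ (D h)) (trans (D-adjoint h (λ _ → 1ℤ))
      (trans (∑-cong pt₁) (trans (∑-* r h) (trans (cong (λ x → r * x) (∑≡0 c)) (ℤₚ.*-zeroʳ r))))))
    λ γ → trans (D-adjoint h (lin γ)) (trans (∑-cong (pt₂ γ))
      (trans (∑-* (r - 1ℤ) (λ S → h S * lin γ S)) (trans (cong (λ x → (r - 1ℤ) * x) (lin⊥ c γ)) (ℤₚ.*-zeroʳ (r - 1ℤ)))))
    where
    id₁ : ∀ h s → h * (s * 1ℤ) ≡ s * h
    id₁ = ℤRing.solve-∀
    pt₁ : ∀ S → h S * U (λ _ → 1ℤ) S ≡ r * h S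
    pt₁ S = trans (cong (λ x → h S * x) (U-const 1ℤ S)) (trans (id₁ (h S) (size S)) (l S))
    id₂ : ∀ h u l → h * u ≡ h * (u + l) - h * l
    id₂ = ℤRing.solve-∀
    id₂′ : ∀ h s l → h * (s * l) - h * l ≡ (s * h) * l - h * l
    id₂′ = ℤRing.solve-∀
    id₂″ : ∀ h r l → (r * h) * l - h * l ≡ (r - 1ℤ) * (h * l)
    id₂″ = ℤRing.solve-∀
    pt₂ : ∀ γ S → h S * U (lin γ) S ≡ (r - 1ℤ) * (h S * lin γ S)
    pt₂ γ S = trans (id₂ (h S) (U (lin γ) S) (lin γ S))
      (trans (cong (λ x → h S * x - h S * lin γ S) (U-lin γ S))
      (trans (id₂′ (h S) (size S) (lin γ S)) (trans (cong (λ x → x * lin γ S - h S * lin γ S) (l S)) (id₂″ (h S) r (lin γ S)))))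

  suc-*-≡0 : ∀ n x → (1ℤ + + n) * x ≡ 0ℤ → x ≡ 0ℤ
  suc-*-≡0 n x e with ℤₚ.i*j≡0⇒i≡0∨j≡0 (1ℤ + + n) e
  ... | inj₂ x≡0 = x≡0

  level-0 : (h : Cube m) → IsLevel 0ℤ h → ∑ h ≡ 0ℤ → ∀ S → h S ≡ 0ℤ
  level-0 h l z [] = z
  level-0 {suc m} h l z = λ { (outside ∷ S) → level-0 (lower h) (l ∘ (outside ∷_)) ∑lower S ; (inside ∷ S) → up S }
    where
    up : ∀ S → upper h S ≡ 0ℤ
    up S = suc-*-≡0 ∣ S ∣ (upper h S) (l (inside ∷ S))
    ∑lower : ∑ (lower h) ≡ 0ℤ
    ∑lower = trans (sym (ℤₚ.+-identityʳ (∑ (lower h)))) (trans (cong (λ x → ∑ (lower h) + x) (sym (∑-zero up))) z)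

  lin-0 : (S : Subset m) → lin (λ _ → 0ℤ) S ≡ 0ℤ
  lin-0 []            = refl
  lin-0 (outside ∷ S) = lin-0 S
  lin-0 (inside ∷ S)  = trans (ℤₚ.+-identityˡ (lin (λ _ → 0ℤ) S)) (lin-0 S)

  -- Every function on singletons is linear, so only zero is orthogonal to all linear functions.
  -- Testing with the first coordinate kills the upper half; the rest is recursion. This starts the
  -- induction for the norm bound.
  level-1 : (h : Cube m) → IsLevel 1ℤ h → (∀ γ → ⟪ h , lin γ ⟫ ≡ 0ℤ) → ∀ S → h S ≡ 0ℤ
  level-1 h l o [] = trans (sym (ℤₚ.*-identityˡ (h []))) (sym (l []))
  level-1 {suc m} h l o = λ
    { (outside ∷ S) → level-1 (lower h) (l ∘ (outside ∷_)) lower⊥ S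
    ; (inside ∷ S) → up≡0 S }
    where
    drop : ∀ s x → (1ℤ + s) * x ≡ 1ℤ * x → s * x ≡ 0ℤ * x
    drop s x e = trans (i s x) (trans (cong (_- x) e) (j x))
      where
      i : ∀ s x → s * x ≡ (1ℤ + s) * x - x
      i = ℤRing.solve-∀
      j : ∀ x → 1ℤ * x - x ≡ 0ℤ * x
      j = ℤRing.solve-∀
    first : Fin (suc m) → ℤ
    first zero    = 1ℤ
    first (suc _) = 0ℤ
    ∑up : ∑ (upper h) ≡ 0ℤ
    ∑up = trans (∑-cong pt) (trans (sym (ℤₚ.+-identityˡ ⟪ upper h , upper (lin first) ⟫))
      (trans (cong (_+ ⟪ upper h , upper (lin first) ⟫) (sym (∑-zero (λ S → trans (cong (λ x → lower h S * x) (lin-0 S)) (ℤₚ.*-zeroʳ (lower h S)))))) (o first)))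
      where
      pt : ∀ S → upper h S ≡ upper h S * (1ℤ + lin (λ _ → 0ℤ) S)
      pt S = trans (sym (ℤₚ.*-identityʳ (upper h S))) (cong (λ x → upper h S * (1ℤ + x)) (sym (lin-0 S)))
    up≡0 : ∀ S → upper h S ≡ 0ℤ
    up≡0 = level-0 (upper h) (λ S → drop (size S) (upper h S) (l (inside ∷ S))) ∑up
    extend : (Fin m → ℤ) → Fin (suc m) → ℤ
    extend γ zero    = 0ℤ
    extend γ (suc i) = γ i
    lower⊥ : ∀ γ → ⟪ lower h , lin γ ⟫ ≡ 0ℤ
    lower⊥ γ = trans (sym (ℤₚ.+-identityʳ ⟪ lower h , lin γ ⟫))
      (trans (cong (λ x → ⟪ lower h , lin γ ⟫ + x)
        (sym (∑-zero (λ S → trans (cong (_* upper (lin (extend γ)) S) (up≡0 S)) (ℤₚ.*-zeroˡ (upper (lin (extend γ)) S))))))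
        (o (extend γ)))

  -- Norm bounds for iterates of the raising operator

  sq-nonneg : ∀ i → 0ℤ ≤ i * i
  sq-nonneg (+ n)        = subst (0ℤ ≤_) (ℤₚ.pos-* n n) (+≤+ ℕ.z≤n)
  sq-nonneg (-[1+ n ]) = +≤+ ℕ.z≤n

  ‖_‖² : Cube m → ℤ
  ‖ h ‖² = ⟪ h , h ⟫

  norm-nonneg : (h : Cube m) → 0ℤ ≤ ‖ h ‖²
  norm-nonneg h = ∑-nonneg (λ S → sq-nonneg (h S))

  norm-zero : {h : Cube m} → (∀ S → h S ≡ 0ℤ) → ‖ h ‖² ≡ 0ℤ
  norm-zero {h = h} z = ∑-zero (λ S → trans (cong (_* h S) (z S)) (ℤₚ.*-zeroˡ (h S)))

  norm-linear : (a b : ℤ) (h k : Cube m) →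
    ‖ (λ S → a * h S + b * k S) ‖² ≡ a * a * ‖ h ‖² + (a * b + a * b) * ⟪ h , k ⟫ + b * b * ‖ k ‖²
  norm-linear a b h k = begin
    ⟪ l , l ⟫ ≡⟨ ⟪⟫-linearʳ l a b h k ⟩
    a * ⟪ l , h ⟫ + b * ⟪ l , k ⟫
      ≡⟨ cong₂ (λ x y → a * x + b * y) (⟪⟫-linearˡ a b h k h) (⟪⟫-linearˡ a b h k k) ⟩
    a * (a * ⟪ h , h ⟫ + b * ⟪ k , h ⟫) + b * (a * ⟪ h , k ⟫ + b * ⟪ k , k ⟫)
      ≡⟨ cong (λ x → a * (a * ⟪ h , h ⟫ + b * x) + b * (a * ⟪ h , k ⟫ + b * ⟪ k , k ⟫)) (⟪⟫-comm k h) ⟩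
    a * (a * ⟪ h , h ⟫ + b * ⟪ h , k ⟫) + b * (a * ⟪ h , k ⟫ + b * ⟪ k , k ⟫)
      ≡⟨ lem a b ‖ h ‖² ⟪ h , k ⟫ ‖ k ‖² ⟩
    a * a * ‖ h ‖² + (a * b + a * b) * ⟪ h , k ⟫ + b * b * ‖ k ‖² ∎
    where
    open ≡-Reasoning
    l = λ S → a * h S + b * k S
    lem : ∀ a b x y z → a * (a * x + b * y) + b * (a * y + b * z) ≡ a * a * x + (a * b + a * b) * y + b * b * z
    lem = ℤRing.solve-∀

  -- Both norms are inner products with `h`, of `D (U h)` and of `U (D h)`; on level `r` the
  -- commutator is multiplication by `m - 2r`.
  energy : (r : ℤ) (h : Cube m) → IsLevel r h → ‖ U h ‖² ≡ ‖ D h ‖² + (+ m - (r + r)) * ‖ h ‖²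
  energy {m} r h l = begin
    ⟪ U h , U h ⟫ ≡⟨ U-adjoint h (U h) ⟩
    ⟪ h , D (U h) ⟫ ≡⟨ ∑-cong pt ⟩
    ∑ (λ S → h S * U (D h) S + (+ m - (r + r)) * (h S * h S))
      ≡⟨ ∑-+ (λ S → h S * U (D h) S) (λ S → (+ m - (r + r)) * (h S * h S)) ⟩
    ⟪ h , U (D h) ⟫ + ∑ (λ S → (+ m - (r + r)) * (h S * h S))
      ≡⟨ cong₂ _+_ (sym (D-adjoint h (D h))) (∑-* (+ m - (r + r)) (λ S → h S * h S)) ⟩
    ⟪ D h , D h ⟫ + (+ m - (r + r)) * ‖ h ‖² ∎
    where
    open ≡-Reasoning
    i : ∀ h d s → h * d ≡ h * (d + (s + s) * h) - (s * h + s * h) * h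
    i = ℤRing.solve-∀
    j : ∀ h u m r → h * (u + m * h) - (r * h + r * h) * h ≡ h * u + (m - (r + r)) * (h * h)
    j = ℤRing.solve-∀
    pt : ∀ S → h S * D (U h) S ≡ h S * U (D h) S + (+ m - (r + r)) * (h S * h S)
    pt S = trans (i (h S) (D (U h) S) (size S))
      (trans (cong₂ (λ x y → h S * x - (y + y) * h S) (commutator h S) (l S)) (j (h S) (U (D h) S) (+ m) r))

  -- Cauchy–Schwarz for ‖Dh‖² = ⟨h, UDh⟩, by expanding ‖c h − UDh‖² ≥ 0.
  lowering-bound : (n : ℕ) (h : Cube m) → let c = + suc n in
    ‖ U (D h) ‖² ≤ c * ‖ D h ‖² → ‖ D h ‖² ≤ c * ‖ h ‖²
  lowering-bound n h p = ℤₚ.*-cancelˡ-≤-pos ‖ D h ‖² (c * ‖ h ‖²) c (ℤₚ.0≤i-j⇒j≤i (subst (0ℤ ≤_) expand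
    (ℤₚ.+-mono-≤ (norm-nonneg (λ S → c * h S + (- 1ℤ) * U (D h) S)) (ℤₚ.i≤j⇒0≤j-i p))))
    where
    c = + suc n
    lem : ∀ c x y z → (c * c * x + (c * - 1ℤ + c * - 1ℤ) * y + - 1ℤ * - 1ℤ * z) + (c * y - z) ≡ c * (c * x) - c * y
    lem = ℤRing.solve-∀
    expand : ‖ (λ S → c * h S + (- 1ℤ) * U (D h) S) ‖² + (c * ‖ D h ‖² - ‖ U (D h) ‖²) ≡ c * (c * ‖ h ‖²) - c * ‖ D h ‖²
    expand = trans (cong (_+ (c * ‖ D h ‖² - ‖ U (D h) ‖²)) (trans (norm-linear c (- 1ℤ) h (U (D h)))
      (cong (λ x → c * c * ‖ h ‖² + (c * - 1ℤ + c * - 1ℤ) * x + - 1ℤ * - 1ℤ * ‖ U (D h) ‖²) (sym (D-adjoint h (D h))))))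
      (lem c ‖ h ‖² ‖ D h ‖² ‖ U (D h) ‖²)

  -- With `r = 1 + ρ` the constant is `(r - 1) * (m - r - 2)`, the eigenvalue of `D ∘ U` on
  -- degree-two harmonics at level `r`; higher degrees have smaller eigenvalues. Instead of
  -- decomposing into harmonics, the induction carries the bound up level by level, through
  -- `lowering-bound` and `energy`.
  raising-bound : (ρ q : ℕ) (h : Cube m) → m ≡ ρ ℕ.+ q ℕ.+ 3 →
    IsLevel (1ℤ + + ρ) h → Centered h → ‖ U h ‖² ≤ + ρ * + q * ‖ h ‖²
  raising-bound zero q h e l c = ℤₚ.≤-reflexive (trans (norm-zero (U-zero (level-1 h l (lin⊥ c))))
    (sym (ℤₚ.*-zeroˡ ‖ h ‖²)))
  raising-bound {m} (suc ρ) q h e l c = ℤₚ.≤-trans (ℤₚ.≤-reflexive (energy r h l))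
    (ℤₚ.≤-trans (ℤₚ.+-monoˡ-≤ ((+ m - (r + r)) * ‖ h ‖²) (lowered ρ refl)) (ℤₚ.≤-reflexive
      (trans (cong (λ x → + ρ * + suc q * ‖ h ‖² + (x - (r + r)) * ‖ h ‖²) +m≡) (lem (+ ρ) (+ q) ‖ h ‖²))))
    where
    r = 1ℤ + (1ℤ + + ρ)
    l′ : IsLevel (1ℤ + + ρ) (D h)
    l′ = D-level (1ℤ + + ρ) h l
    c′ = D-centered r h l c
    -- `D h` lies one level lower in the same cube, so `ρ` drops by one and `q` grows by one.
    IH : ‖ U (D h) ‖² ≤ + ρ * + suc q * ‖ D h ‖²
    IH = raising-bound ρ (suc q) (D h) (trans e (cong (ℕ._+ 3) (sym (ℕₚ.+-suc ρ q)))) l′ c′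
    +m≡ : + m ≡ + ρ + + q + + 4
    +m≡ = trans (cong +_ e) (cong +_ (sym (ℕₚ.+-suc (ρ ℕ.+ q) 3)))
    lem : ∀ ρ q x → ρ * (1ℤ + q) * x + (ρ + q + + 4 - ((1ℤ + (1ℤ + ρ)) + (1ℤ + (1ℤ + ρ)))) * x ≡ (1ℤ + ρ) * q * x
    lem = ℤRing.solve-∀
    -- `lowering-bound` cancels a positive constant. For `ρ = 0` the constant is zero, but then
    -- `D h` is a centered function on singletons and vanishes.
    lowered : ∀ ρ′ → ρ′ ≡ ρ → ‖ D h ‖² ≤ + ρ * + suc q * ‖ h ‖²
    lowered zero    refl = ℤₚ.≤-reflexive (trans (norm-zero (level-1 (D h) l′ (lin⊥ c′))) (sym (ℤₚ.*-zeroˡ ‖ h ‖²)))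
    lowered (suc n) refl = lowering-bound (q ℕ.+ n ℕ.* suc q) h IH

  choose-factorial : ∀ i j → ((i ℕ.+ j) C i) ℕ.* (i ! ℕ.* j !) ≡ (i ℕ.+ j) !
  choose-factorial i j = trans
    (cong₂ (λ x y → x ℕ.* (i ! ℕ.* y !)) (nCk≡n!/k![n-k]! i≤) (sym (ℕₚ.m+n∸m≡n i j)))
    (ℕ/.m/n*n≡m (k![n∸k]!∣n! i≤))
    where
    i≤ : i ℕ.≤ i ℕ.+ j
    i≤ = ℕₚ.m≤m+n i j
    instance
      _ = ℕₚ.m*n≢0 (i !) ((i ℕ.+ j ℕ.∸ i) !) {{i ℕₚ.!≢0}} {{(i ℕ.+ j ℕ.∸ i) ℕₚ.!≢0}}

  absorption : ∀ n k → suc n ℕ.* (n C k) ≡ suc k ℕ.* (suc n C suc k)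
  absorption n zero = trans (ℕₚ.*-identityʳ (suc n)) (sym (trans (ℕₚ.*-identityˡ (suc n C 1)) (nC1≡n (suc n))))
  absorption zero (suc k) = sym (trans (cong (suc (suc k) ℕ.*_) (k>n⇒nCk≡0 {1} {suc (suc k)} (ℕ.s≤s (ℕ.s≤s ℕ.z≤n)))) (ℕₚ.*-zeroʳ (suc (suc k))))
  absorption (suc n) (suc k) = begin
    suc (suc n) ℕ.* C₁
      ≡⟨ cong (λ x → C₁ ℕ.+ suc n ℕ.* x) (sym (nCk+nC[k+1]≡[n+1]C[k+1] n k)) ⟩
    C₁ ℕ.+ suc n ℕ.* ((n C k) ℕ.+ (n C suc k))
      ≡⟨ cong (C₁ ℕ.+_) (ℕₚ.*-distribˡ-+ (suc n) (n C k) (n C suc k)) ⟩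
    C₁ ℕ.+ (suc n ℕ.* (n C k) ℕ.+ suc n ℕ.* (n C suc k))
      ≡⟨ cong₂ (λ x y → C₁ ℕ.+ (x ℕ.+ y)) (absorption n k) (absorption n (suc k)) ⟩
    C₁ ℕ.+ (suc k ℕ.* C₁ ℕ.+ suc (suc k) ℕ.* C₂)
      ≡⟨ lem k C₁ C₂ ⟩
    suc (suc k) ℕ.* (C₁ ℕ.+ C₂)
      ≡⟨ cong (suc (suc k) ℕ.*_) (nCk+nC[k+1]≡[n+1]C[k+1] (suc n) (suc k)) ⟩
    suc (suc k) ℕ.* (suc (suc n) C suc (suc k)) ∎
    where
    open ≡-Reasoning
    C₁ = suc n C suc k
    C₂ = suc n C suc (suc k)
    lem : ∀ k a b → a ℕ.+ (suc k ℕ.* a ℕ.+ suc (suc k) ℕ.* b) ≡ suc (suc k) ℕ.* (a ℕ.+ b)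
    lem = ℕRing.solve-∀

  choose-positive : ∀ i j → ℕ.NonZero ((i ℕ.+ j) C i)
  choose-positive i j = ℕₚ.m*n≢0⇒m≢0 ((i ℕ.+ j) C i) {{subst ℕ.NonZero (sym (choose-factorial i j)) ((i ℕ.+ j) ℕₚ.!≢0)}}

  *-mono-nonneg : ∀ {c x y} → 0ℤ ≤ c → x ≤ y → c * x ≤ c * y
  *-mono-nonneg {+ n} p q = ℤₚ.*-monoˡ-≤-nonNeg (+ n) q

  U^ : ℕ → Cube m → Cube m
  U^ zero    h = h
  U^ (suc i) h = U (U^ i h)

  module _ {α p : ℕ} (h : Cube m) (m≡ : m ≡ α ℕ.+ p ℕ.+ 4)
           (level : IsLevel (+ suc (suc α)) h) (cent : Centered h) where

    U^-level : ∀ i → IsLevel (+ suc (suc (i ℕ.+ α))) (U^ i h)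
    U^-level zero    = level
    U^-level (suc i) = U-level (+ suc (suc (i ℕ.+ α))) (U^ i h) (U^-level i)

    U^-centered : ∀ i → Centered (U^ i h)
    U^-centered zero    = cent
    U^-centered (suc i) = U-centered (+ suc (suc (i ℕ.+ α))) (U^ i h) (U^-level i) (U^-centered i)

    -- Step `i` starts at level `i + α + 2` and costs the factor `(i + α + 1) * (p - i)`; the
    -- product telescopes into two factorial quotients. At `j = α` both quotients equal p!/α!, so
    -- the bound becomes a perfect square.
    U^-bound : ∀ i j → i ℕ.+ j ≡ p →
      + (α !) * + (j !) * ‖ U^ i h ‖² ≤ + ((i ℕ.+ α) !) * + (p !) * ‖ h ‖²
    U^-bound zero    j refl = ℤₚ.≤-refl
    U^-bound (suc i) j e = begin
      A * J * ‖ U^ (suc i) h ‖²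
        ≤⟨ *-mono-nonneg {A * J} (subst (0ℤ ≤_) (ℤₚ.pos-* (α !) (j !)) (+≤+ ℕ.z≤n))
             (raising-bound (suc (i ℕ.+ α)) (suc j) (U^ i h) m≡′ (U^-level i) (U^-centered i)) ⟩
      A * J * (R * + suc j * ‖ U^ i h ‖²)
        ≡⟨ lem₁ A J R (+ suc j) ‖ U^ i h ‖² ⟩
      R * (A * (+ suc j * J) * ‖ U^ i h ‖²)
        ≡⟨ cong (λ x → R * (A * x * ‖ U^ i h ‖²)) (sym (ℤₚ.pos-* (suc j) (j !))) ⟩
      R * (A * + (suc j !) * ‖ U^ i h ‖²)
        ≤⟨ ℤₚ.*-monoˡ-≤-nonNeg R (U^-bound i (suc j) (trans (ℕₚ.+-suc i j) e)) ⟩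
      R * (+ ((i ℕ.+ α) !) * + (p !) * ‖ h ‖²)
        ≡⟨ lem₂ R (+ ((i ℕ.+ α) !)) (+ (p !)) ‖ h ‖² ⟩
      (R * + ((i ℕ.+ α) !)) * + (p !) * ‖ h ‖²
        ≡⟨ cong (λ x → x * + (p !) * ‖ h ‖²) (sym (ℤₚ.pos-* (suc (i ℕ.+ α)) ((i ℕ.+ α) !))) ⟩
      + ((suc i ℕ.+ α) !) * + (p !) * ‖ h ‖² ∎
      where
      open ℤₚ.≤-Reasoning
      A = + (α !)
      J = + (j !)
      R = + suc (i ℕ.+ α)
      m≡′ : m ≡ suc (i ℕ.+ α) ℕ.+ suc j ℕ.+ 3
      m≡′ = trans m≡ (trans (cong (λ x → α ℕ.+ x ℕ.+ 4) (sym e)) (lem α i j))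
        where
        lem : ∀ α i j → α ℕ.+ suc (i ℕ.+ j) ℕ.+ 4 ≡ suc (i ℕ.+ α) ℕ.+ suc j ℕ.+ 3
        lem = ℕRing.solve-∀
      lem₁ : ∀ a j r s n → a * j * (r * s * n) ≡ r * (a * (s * j) * n)
      lem₁ = ℤRing.solve-∀
      lem₂ : ∀ r f p n → r * (f * p * n) ≡ (r * f) * p * n
      lem₂ = ℤRing.solve-∀

  -- Iterated raising as a subset sum, and subset sums of linear functions

  lev-size : (t : ℕ) (S : Subset m) → lev t S * size S ≡ lev t S * + t
  lev-size zero    []            = refl
  lev-size (suc t) []            = refl
  lev-size zero    (outside ∷ S) = lev-size zero S
  lev-size (suc t) (outside ∷ S) = lev-size (suc t) S
  lev-size zero    (inside ∷ S)  = refl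
  lev-size (suc t) (inside ∷ S)  = trans (lem (lev t S) (size S)) (trans (cong (λ x → lev t S + x) (lev-size t S)) (sym (lem (lev t S) (+ t))))
    where
    lem : ∀ l s → l * (1ℤ + s) ≡ l + l * s
    lem = ℤRing.solve-∀

  lev-1 : {t : ℕ} (S : Subset m) → ∣ S ∣ ≡ t → lev t S ≡ 1ℤ
  lev-1 []            refl = refl
  lev-1 (outside ∷ S) refl = lev-1 S refl
  lev-1 (inside ∷ S)  refl = lev-1 S refl

  level⇒zero : {a : ℕ} {h : Cube m} → IsLevel (+ a) h → ∀ S → ∣ S ∣ ≢ a → h S ≡ 0ℤ
  level⇒zero {a = a} {h} l S ≢a with ℤₚ.i*j≡0⇒i≡0∨j≡0 (size S - + a)
    (trans (lem (size S) (+ a) (h S)) (trans (cong (_- + a * h S) (l S)) (ℤₚ.+-inverseʳ (+ a * h S))))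
    where
    lem : ∀ s a x → (s - a) * x ≡ s * x - a * x
    lem = ℤRing.solve-∀
  ... | inj₁ e = contradiction (ℤₚ.+-injective (ℤₚ.i-j≡0⇒i≡j (size S) (+ a) e)) ≢a
  ... | inj₂ e = e

  lev-zero : {t : ℕ} (S : Subset m) → ∣ S ∣ ≢ t → lev t S ≡ 0ℤ
  lev-zero {t = t} = level⇒zero {a = t} {h = lev t}
    (λ S → trans (ℤₚ.*-comm (size S) (lev t S)) (trans (lev-size t S) (ℤₚ.*-comm (lev t S) (+ t))))

  level-ζ : (a : ℕ) (h : Cube m) → IsLevel (+ a) h → ∀ S → h S ≡ lev a S * ζ h S
  level-ζ a h l S with ∣ S ∣ ℕ.≟ a
  ... | yes refl = sym (trans (cong (_* ζ h S) (lev-1 S refl)) (trans (ℤₚ.*-identityˡ (ζ h S))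
    (ζ-minimal h S λ B B< → level⇒zero l B (ℕₚ.<⇒≢ B<))))
  ... | no ≢a = trans (level⇒zero l S ≢a) (sym (trans (cong (_* ζ h S) (lev-zero S ≢a)) (ℤₚ.*-zeroˡ (ζ h S))))

  ζ-* : (c : ℤ) (h : Cube m) → ∀ S → ζ (λ T → c * h T) S ≡ c * ζ h S
  ζ-* c h []            = refl
  ζ-* c h (outside ∷ S) = ζ-* c (lower h) S
  ζ-* c h (inside ∷ S)  = trans (cong₂ _+_ (ζ-* c (lower h) S) (ζ-* c (upper h) S)) (sym (ℤₚ.*-distribˡ-+ c (ζ (lower h) S) (ζ (upper h) S)))

  -- An `a`-set inside an `(i + a)`-set is joined to it by i! chains, one for each order of adding
  -- the missing elements. Evaluated at complements, this compares iterated raising with `K`.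
  U^-ζ : (a : ℕ) (h : Cube m) → IsLevel (+ a) h → ∀ i S → U^ i h S ≡ + (i !) * (lev (i ℕ.+ a) S * ζ h S)
  U^-ζ a h l zero    S = trans (level-ζ a h l S) (sym (ℤₚ.*-identityˡ (lev a S * ζ h S)))
  U^-ζ a h l (suc i) S = begin
    U (U^ i h) S
      ≡⟨ U-cong (U^-ζ a h l i) S ⟩
    U (λ T → I * (lev (i ℕ.+ a) T * ζ h T)) S
      ≡⟨ U-* I (λ T → lev (i ℕ.+ a) T * ζ h T) S ⟩
    I * U (λ T → lev (i ℕ.+ a) T * ζ h T) S
      ≡⟨ cong (λ x → I * x) (U-lev (i ℕ.+ a) (ζ h) S) ⟩
    I * (L * U (ζ h) S)
      ≡⟨ cong (λ x → I * (L * x)) Uζ ⟩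
    I * (L * (size S * Z - + a * Z))
      ≡⟨ lem₁ I L (size S) Z (+ a) ⟩
    I * ((L * size S) * Z - L * + a * Z)
      ≡⟨ cong (λ x → I * (x * Z - L * + a * Z)) (lev-size (suc i ℕ.+ a) S) ⟩
    I * ((L * (+ suc i + + a)) * Z - L * + a * Z)
      ≡⟨ lem₂ I L (+ suc i) (+ a) Z ⟩
    (+ suc i * I) * (L * Z)
      ≡⟨ cong (_* (L * Z)) (sym (ℤₚ.pos-* (suc i) (i !))) ⟩
    + (suc i !) * (L * Z) ∎
    where
    open ≡-Reasoning
    I = + (i !)
    L = lev (suc i ℕ.+ a) S
    Z = ζ h S
    add-sub : ∀ x y → x ≡ (x + y) - y
    add-sub = ℤRing.solve-∀
    Uζ : U (ζ h) S ≡ size S * Z - + a * Z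
    Uζ = trans (add-sub (U (ζ h) S) (ζ (λ T → size T * h T) S)) (cong₂ _-_ (U-ζ h S) (trans (ζ-cong l S) (ζ-* (+ a) h S)))
    lem₁ : ∀ i l s z a → i * (l * (s * z - a * z)) ≡ i * ((l * s) * z - l * a * z)
    lem₁ = ℤRing.solve-∀
    lem₂ : ∀ i l s a z → i * ((l * (s + a)) * z - l * a * z) ≡ (s * i) * (l * z)
    lem₂ = ℤRing.solve-∀

  ζ-zero : {h : Cube m} → (∀ S → h S ≡ 0ℤ) → ∀ S → ζ h S ≡ 0ℤ
  ζ-zero z S = ζ-vanish _ S (λ B _ → z B)

  ζ-lev : (a : ℕ) (B : Subset m) → ζ (lev a) B ≡ + (∣ B ∣ C a)
  ζ-lev zero    []            = refl
  ζ-lev (suc a) []            = refl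
  ζ-lev zero    (outside ∷ B) = ζ-lev zero B
  ζ-lev (suc a) (outside ∷ B) = ζ-lev (suc a) B
  ζ-lev zero    (inside ∷ B)  = cong₂ _+_ (ζ-lev zero B) (ζ-zero (λ _ → refl) B)
  ζ-lev (suc a) (inside ∷ B)  = trans (cong₂ _+_ (ζ-lev (suc a) B) (ζ-lev a B))
    (cong +_ (trans (ℕₚ.+-comm (∣ B ∣ C suc a) (∣ B ∣ C a)) (nCk+nC[k+1]≡[n+1]C[k+1] ∣ B ∣ a)))

  lin-empty : (γ : Fin m → ℤ) (B : Subset m) → ∣ B ∣ ≡ 0 → lin γ B ≡ 0ℤ
  lin-empty γ []            e = refl
  lin-empty γ (outside ∷ B) e = lin-empty (γ ∘ suc) B e

  lev₀-lin : (γ : Fin m → ℤ) (S : Subset m) → lev 0 S * lin γ S ≡ 0ℤ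
  lev₀-lin γ []            = refl
  lev₀-lin γ (outside ∷ S) = lev₀-lin (γ ∘ suc) S
  lev₀-lin γ (inside ∷ S)  = ℤₚ.*-zeroˡ (lin γ (inside ∷ S))

  -- Each element of `B` lies in C(|B| - 1, a) of the `(a + 1)`-subsets of `B`. Hence `K` sends a
  -- linear function on one level to an affine function on each level.
  ζ-lev-lin : (a : ℕ) (γ : Fin m → ℤ) (B : Subset m) →
    ζ (λ S → lev (suc a) S * lin γ S) B ≡ + (ℕ.pred ∣ B ∣ C a) * lin γ B
  ζ-lev-lin a γ []            = sym (ℤₚ.*-zeroʳ (+ (0 C a)))
  ζ-lev-lin a γ (outside ∷ B) = ζ-lev-lin a (γ ∘ suc) B
  ζ-lev-lin {suc m} a γ (inside ∷ B)  = begin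
    ζ (λ S → lev (suc a) S * lin γ′ S) B + ζ (λ S → lev a S * (γ zero + lin γ′ S)) B
      ≡⟨ cong₂ _+_ (ζ-lev-lin a γ′ B)
           (trans (ζ-cong (λ S → lem₀ (lev a S) (γ zero) (lin γ′ S)) B) (ζ-linear (γ zero) 1ℤ (lev a) (λ S → lev a S * lin γ′ S) B)) ⟩
    + (ℕ.pred ∣ B ∣ C a) * l + (γ zero * ζ (lev a) B + 1ℤ * ζ (λ S → lev a S * lin γ′ S) B)
      ≡⟨ cong (λ x → + (ℕ.pred ∣ B ∣ C a) * l + (γ zero * x + 1ℤ * ζ (λ S → lev a S * lin γ′ S) B)) (ζ-lev a B) ⟩
    + (ℕ.pred ∣ B ∣ C a) * l + (γ zero * + (∣ B ∣ C a) + 1ℤ * ζ (λ S → lev a S * lin γ′ S) B)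
      ≡⟨ lem₁ (+ (ℕ.pred ∣ B ∣ C a) * l) (γ zero) (+ (∣ B ∣ C a)) (ζ (λ S → lev a S * lin γ′ S) B) ⟩
    (+ (ℕ.pred ∣ B ∣ C a) * l + ζ (λ S → lev a S * lin γ′ S) B) + γ zero * + (∣ B ∣ C a)
      ≡⟨ cong (_+ γ zero * + (∣ B ∣ C a)) (pascal a ∣ B ∣ refl) ⟩
    + (∣ B ∣ C a) * l + γ zero * + (∣ B ∣ C a)
      ≡⟨ lem₂ (+ (∣ B ∣ C a)) l (γ zero) ⟩
    + (∣ B ∣ C a) * (γ zero + l) ∎
    where
    open ≡-Reasoning
    γ′ : Fin m → ℤ
    γ′ = γ ∘ suc
    l = lin γ′ B
    lem₀ : ∀ v g l → v * (g + l) ≡ g * v + 1ℤ * (v * l)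
    lem₀ = ℤRing.solve-∀
    lem₁ : ∀ x g c z → x + (g * c + 1ℤ * z) ≡ (x + z) + g * c
    lem₁ = ℤRing.solve-∀
    lem₂ : ∀ c l g → c * l + g * c ≡ c * (g + l)
    lem₂ = ℤRing.solve-∀
    pascal : ∀ a n → n ≡ ∣ B ∣ → + (ℕ.pred n C a) * l + ζ (λ S → lev a S * lin γ′ S) B ≡ + (n C a) * l
    pascal zero    n e = trans (cong (λ x → 1ℤ * l + x) (ζ-zero (lev₀-lin γ′) B)) (ℤₚ.+-identityʳ (1ℤ * l))
    -- The binomial identity alone can fail here, since 0 C 0 = 1 while 0 C 1 = 0; it is rescued by
    -- the factor `l`, which is zero for empty `B`.
    pascal (suc a) zero e = trans (cong₂ _+_ (vanish (0 C suc a)) (trans (ζ-lev-lin a γ′ B) (vanish (ℕ.pred ∣ B ∣ C a)))) (sym (vanish (0 C suc a)))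
      where
      vanish : ∀ c → + c * l ≡ 0ℤ
      vanish c = trans (cong (λ x → + c * x) (lin-empty γ′ B (sym e))) (ℤₚ.*-zeroʳ (+ c))
    pascal (suc a) (suc n) e = trans (cong (λ x → + (n C suc a) * l + x) (trans (ζ-lev-lin a γ′ B) (cong (λ k → + (ℕ.pred k C a) * l) (sym e))))
      (trans (sym (ℤₚ.*-distribʳ-+ l (+ (n C suc a)) (+ (n C a))))
        (cong (λ x → + x * l) (trans (ℕₚ.+-comm (n C suc a) (n C a)) (nCk+nC[k+1]≡[n+1]C[k+1] n a))))

  K-vanish : (h : Cube m) (S : Subset m) → (∀ B → Empty (S ∩ B) → h B ≡ 0ℤ) → K h S ≡ 0ℤ
  K-vanish h [] z = z [] λ ()
  K-vanish h (outside ∷ S) z = cong₂ _+_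
    (K-vanish (lower h) S λ B e → z (outside ∷ B) (λ { (suc i , there q) → e (i , q) }))
    (K-vanish (upper h) S λ B e → z (inside ∷ B) (λ { (suc i , there q) → e (i , q) }))
  K-vanish h (inside ∷ S) z =
    K-vanish (lower h) S λ B e → z (outside ∷ B) (λ { (suc i , there q) → e (i , q) })

  -- The numerical contradiction

  0≤1 : 0ℤ ≤ 1ℤ
  0≤1 = +≤+ ℕ.z≤n

  +-nonneg : ∀ {x y} → 0ℤ ≤ x → 0ℤ ≤ y → 0ℤ ≤ x + y
  +-nonneg p q = ℤₚ.+-mono-≤ p q

  *-nonneg : ∀ {x y} → 0ℤ ≤ x → 0ℤ ≤ y → 0ℤ ≤ x * y
  *-nonneg {x} {y} p q = subst (_≤ x * y) (ℤₚ.*-zeroʳ x) (*-mono-nonneg p q)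

  -- In the deviations C₁ − X, C₁ − Y with sum σ and product π, the spectral inequality reads
  -- κ C₁ A σ < B π.  If σ ≤ 0 it contradicts 2π ≤ C₁ σ, and if σ ≥ 0 it contradicts 4π ≤ σ² and a σ ≤ 2C.
  deviation-contradiction : ∀ a κ C₁ A B σ π w → 0ℤ ≤ a → 0ℤ ≤ κ → 0ℤ ≤ C₁ → 1ℤ ≤ a * w → 1ℤ ≤ w →
    0ℤ ≤ B → 0ℤ ≤ B - + 2 * A * κ → 0ℤ ≤ + 2 * a * C₁ * A - B →
    0ℤ ≤ σ * σ - + 4 * π → 0ℤ ≤ + 2 * κ - a * σ → 0ℤ ≤ C₁ * σ - + 2 * π →
    0ℤ ≤ B * π - κ * C₁ * A * σ - w → ⊥
  deviation-contradiction a κ C₁ A B σ π w 0≤a 0≤C 0≤C₁ 1≤aw 1≤w 0≤B B≥ B≤ disc aσ≤ 2π≤ key = split (ℤₚ.≤-total 0ℤ σ)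
    where
    neg : ∀ x → 1ℤ ≤ x → 0ℤ ≤ - x → ⊥
    neg x p q with ℤₚ.≤-trans (+-nonneg (ℤₚ.i≤j⇒0≤j-i p) q) (ℤₚ.≤-reflexive (lem x))
      where
      lem : ∀ x → (x - 1ℤ) + - x ≡ - 1ℤ
      lem = ℤRing.solve-∀
    ... | ()
    two-neg : ∀ x → 1ℤ ≤ x → 0ℤ ≤ - (+ 2 * x) → ⊥
    two-neg x p q = neg x p (ℤₚ.≤-trans (+-nonneg q (ℤₚ.≤-trans (+≤+ ℕ.z≤n) p)) (ℤₚ.≤-reflexive (lem x)))
      where
      lem : ∀ x → - (+ 2 * x) + x ≡ - x
      lem = ℤRing.solve-∀
    -- Certificates: nonnegative multiples of the hypotheses add up to a negative number. The
    -- weights make all terms in `π` and `σ` cancel; `id₁` serves `σ ≤ 0` and `id₂` serves `0 ≤ σ`.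
    id₁ : ∀ B π κ C₁ A σ w → + 2 * (B * π - κ * C₁ * A * σ - w) + B * (C₁ * σ - + 2 * π) + C₁ * - σ * (B - + 2 * A * κ) ≡ - (+ 2 * w)
    id₁ = ℤRing.solve-∀
    id₂ : ∀ a B π κ C₁ A σ w → + 4 * a * (B * π - κ * C₁ * A * σ - w) + a * B * (σ * σ - + 4 * π) + B * σ * (+ 2 * κ - a * σ)
      + + 2 * κ * σ * (+ 2 * a * C₁ * A - B) ≡ - (+ 2 * (+ 2 * (a * w)))
    id₂ = ℤRing.solve-∀
    0≤n : ∀ {n} → 0ℤ ≤ + n
    0≤n = +≤+ ℕ.z≤n
    split : 0ℤ ≤ σ ⊎ σ ≤ 0ℤ → ⊥
    split (inj₂ σ≤0) = two-neg w 1≤w (subst (0ℤ ≤_) (id₁ B π κ C₁ A σ w)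
      (+-nonneg (+-nonneg (*-nonneg (0≤n {2}) key) (*-nonneg 0≤B 2π≤)) (*-nonneg (*-nonneg 0≤C₁ (ℤₚ.neg-mono-≤ σ≤0)) B≥)))
    split (inj₁ 0≤σ) = two-neg (a * w) 1≤aw (drop (subst (0ℤ ≤_) (id₂ a B π κ C₁ A σ w)
      (+-nonneg (+-nonneg (+-nonneg (*-nonneg (*-nonneg (0≤n {4}) 0≤a) key) (*-nonneg (*-nonneg 0≤a 0≤B) disc))
        (*-nonneg (*-nonneg 0≤B 0≤σ) aσ≤)) (*-nonneg (*-nonneg (*-nonneg (0≤n {2}) 0≤C) 0≤σ) B≤))))
      where
      half : ∀ x → - (+ 2 * x) + x ≡ - x
      half = ℤRing.solve-∀
      drop : 0ℤ ≤ - (+ 2 * (+ 2 * (a * w))) → 0ℤ ≤ - (+ 2 * (a * w))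
      drop p = ℤₚ.≤-trans (+-nonneg p (*-nonneg (0≤n {2}) (ℤₚ.≤-trans 0≤n 1≤aw))) (ℤₚ.≤-reflexive (half (+ 2 * (a * w))))

  -- In the application `P` is the sum of the products of the degrees, `C₁ * P - a * Δ * X * Y` is
  -- the inner product `Q` of the spectral inequality, and `W` is the number of points times `Δ`, so
  -- that `a * X - W` is the total excess of the degrees over `Δ`. Replacing `P` by its upper bound
  -- leaves an inequality in `C₁ - X` and `C₁ - Y` only.
  spectral-contradiction : ∀ a κ Δ μ λ′ X Y P → let C₁ = κ + Δ; W = a * C₁ - κ in
    1ℤ ≤ a → 0ℤ ≤ κ → 0ℤ ≤ W → 1ℤ ≤ C₁ → 0ℤ ≤ λ′ → 1ℤ ≤ μ - λ′ → 0ℤ ≤ (a - 1ℤ) * μ - a * λ′ →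
    0ℤ ≤ a * X - W → 0ℤ ≤ a * Y - W →
    0ℤ ≤ W * Δ + Δ * ((a * X - W) + (a * Y - W)) + (a * X - W) * (a * Y - W) - P - 1ℤ →
    0ℤ ≤ + 2 * (μ - λ′) * (C₁ * P - a * Δ * X * Y) + λ′ * κ * C₁ * (X + Y) - + 2 * μ * κ * X * Y →
    0ℤ ≤ C₁ * (X + Y) - + 2 * X * Y → ⊥
  spectral-contradiction a κ Δ μ λ′ X Y P 1≤a 0≤C 0≤W 1≤C₁ 0≤λ 1≤μ-λ gap E≥0 E′≥0 P≤ spec harm =
    deviation-contradiction a κ C₁ A B σ π w 0≤a 0≤C 0≤C₁ (1≤* 1≤a 1≤w) 1≤w 0≤B B≥ B≤
      (subst (0ℤ ≤_) (disc C₁ X Y) (sq-nonneg (X - Y)))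
      (subst (0ℤ ≤_) (dev a κ C₁ X Y) (+-nonneg E≥0 E′≥0))
      (subst (0ℤ ≤_) (hm C₁ X Y) harm)
      (subst (0ℤ ≤_) (trans (spec-id₁ a κ Δ (μ - λ′) μ λ′ X Y P) (trans (cong (λ x → + 2 * (μ - λ′) * (x - C₁) + λ′ * κ * C₁ * (X + Y) - + 2 * μ * κ * X * Y)
        (q-id a κ Δ X Y)) (spec-id₂ a κ C₁ Δ μ λ′ X Y)))
        (+-nonneg spec (*-nonneg (*-nonneg (*-nonneg 0≤2 0≤μ-λ) 0≤C₁) P≤)))
    where
    C₁ = κ + Δ
    W = a * C₁ - κ
    A = + 2 * ((a - 1ℤ) * μ - a * λ′) + λ′
    B = + 2 * (μ - λ′) * (a * a * C₁ - a * Δ) - + 2 * μ * κ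
    σ = + 2 * C₁ - X - Y
    π = (C₁ - X) * (C₁ - Y)
    -- The one unit of strictness in the bound on `P`, times the multiplier of that bound. It is all
    -- that remains when `X` and `Y` both equal `C₁`.
    w = + 2 * (μ - λ′) * C₁
    0≤2 : 0ℤ ≤ + 2
    0≤2 = +-nonneg 0≤1 0≤1
    0≤a = ℤₚ.≤-trans 0≤1 1≤a
    0≤C₁ = ℤₚ.≤-trans 0≤1 1≤C₁
    0≤μ-λ = ℤₚ.≤-trans 0≤1 1≤μ-λ
    1≤* : ∀ {x y} → 1ℤ ≤ x → 1ℤ ≤ y → 1ℤ ≤ x * y
    1≤* {x} {y} p q = ℤₚ.≤-trans p (subst (_≤ x * y) (ℤₚ.*-identityʳ x) (*-mono-nonneg (ℤₚ.≤-trans 0≤1 p) q))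
    1≤w : 1ℤ ≤ w
    1≤w = 1≤* (1≤* {+ 2} (ℤₚ.+-mono-≤ (ℤₚ.≤-refl {1ℤ}) 0≤1) 1≤μ-λ) 1≤C₁
    A≥0 : 0ℤ ≤ A
    A≥0 = +-nonneg (*-nonneg 0≤2 gap) 0≤λ
    B≥-id : ∀ a κ Δ μ λ′ → + 2 * (μ - λ′) * ((a - 1ℤ) * (a * (κ + Δ) - κ)) ≡
      (+ 2 * (μ - λ′) * (a * a * (κ + Δ) - a * Δ) - + 2 * μ * κ) - + 2 * (+ 2 * ((a - 1ℤ) * μ - a * λ′) + λ′) * κ
    B≥-id = ℤRing.solve-∀
    B≥ : 0ℤ ≤ B - + 2 * A * κ
    B≥ = subst (0ℤ ≤_) (B≥-id a κ Δ μ λ′) (*-nonneg (*-nonneg 0≤2 0≤μ-λ) (*-nonneg (ℤₚ.i≤j⇒0≤j-i 1≤a) 0≤W))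
    B≤-id : ∀ a κ Δ μ λ′ → + 2 * ((a * (κ + Δ) - κ) * ((a - 1ℤ) * μ - a * λ′)) ≡
      + 2 * a * (κ + Δ) * (+ 2 * ((a - 1ℤ) * μ - a * λ′) + λ′) - (+ 2 * (μ - λ′) * (a * a * (κ + Δ) - a * Δ) - + 2 * μ * κ)
    B≤-id = ℤRing.solve-∀
    B≤ : 0ℤ ≤ + 2 * a * C₁ * A - B
    B≤ = subst (0ℤ ≤_) (B≤-id a κ Δ μ λ′) (*-nonneg 0≤2 (*-nonneg 0≤W gap))
    0≤B : 0ℤ ≤ B
    0≤B = subst (0ℤ ≤_) (lem B (+ 2 * A * κ)) (+-nonneg B≥ (*-nonneg (*-nonneg 0≤2 A≥0) 0≤C))
      where
      lem : ∀ x y → (x - y) + y ≡ x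
      lem = ℤRing.solve-∀
    disc : ∀ C₁ X Y → (X - Y) * (X - Y) ≡ (+ 2 * C₁ - X - Y) * (+ 2 * C₁ - X - Y) - + 4 * ((C₁ - X) * (C₁ - Y))
    disc = ℤRing.solve-∀
    dev : ∀ a κ C₁ X Y → (a * X - (a * C₁ - κ)) + (a * Y - (a * C₁ - κ)) ≡ + 2 * κ - a * (+ 2 * C₁ - X - Y)
    dev = ℤRing.solve-∀
    hm : ∀ C₁ X Y → C₁ * (X + Y) - + 2 * X * Y ≡ C₁ * (+ 2 * C₁ - X - Y) - + 2 * ((C₁ - X) * (C₁ - Y))
    hm = ℤRing.solve-∀
    Smax = W * Δ + Δ * ((a * X - W) + (a * Y - W)) + (a * X - W) * (a * Y - W)
    spec-alg : ∀ S P C₁ ν XY R → + 2 * ν * (C₁ * P - XY) + R + + 2 * ν * C₁ * (S - P - 1ℤ) ≡ + 2 * ν * ((C₁ * S - XY) - C₁) + R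
    spec-alg = ℤRing.solve-∀
    assoc : ∀ x y z → x + y - z ≡ x + (y - z)
    assoc = ℤRing.solve-∀
    spec-id₁ : ∀ a κ Δ ν μ λ′ X Y P → let C₁ = κ + Δ; W = a * C₁ - κ; S = W * Δ + Δ * ((a * X - W) + (a * Y - W)) + (a * X - W) * (a * Y - W) in
      (+ 2 * ν * (C₁ * P - a * Δ * X * Y) + λ′ * κ * C₁ * (X + Y) - + 2 * μ * κ * X * Y) + + 2 * ν * C₁ * (S - P - 1ℤ) ≡
      + 2 * ν * ((C₁ * S - a * Δ * X * Y) - C₁) + λ′ * κ * C₁ * (X + Y) - + 2 * μ * κ * X * Y
    spec-id₁ a κ Δ ν μ λ′ X Y P = trans (cong (_+ + 2 * ν * C′ * (S′ - P - 1ℤ)) (assoc (+ 2 * ν * (C′ * P - a * Δ * X * Y)) (λ′ * κ * C′ * (X + Y)) (+ 2 * μ * κ * X * Y)))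
      (trans (spec-alg S′ P C′ ν (a * Δ * X * Y) (λ′ * κ * C′ * (X + Y) - + 2 * μ * κ * X * Y))
        (sym (assoc (+ 2 * ν * ((C′ * S′ - a * Δ * X * Y) - C′)) (λ′ * κ * C′ * (X + Y)) (+ 2 * μ * κ * X * Y))))
      where
      C′ = κ + Δ
      W′ = a * C′ - κ
      S′ = W′ * Δ + Δ * ((a * X - W′) + (a * Y - W′)) + (a * X - W′) * (a * Y - W′)
    q-id : ∀ a κ Δ X Y → let C₁ = κ + Δ; W = a * C₁ - κ in
      C₁ * (W * Δ + Δ * ((a * X - W) + (a * Y - W)) + (a * X - W) * (a * Y - W)) - a * Δ * X * Y ≡
      κ * C₁ * (C₁ - a * (+ 2 * C₁ - X - Y)) + (C₁ - X) * (C₁ - Y) * (a * a * C₁ - a * Δ)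
    q-id = ℤRing.solve-∀
    spec-id₂ : ∀ a κ C₁ Δ μ λ′ X Y →
      + 2 * (μ - λ′) * ((κ * C₁ * (C₁ - a * (+ 2 * C₁ - X - Y)) + (C₁ - X) * (C₁ - Y) * (a * a * C₁ - a * Δ)) - C₁)
        + λ′ * κ * C₁ * (X + Y) - + 2 * μ * κ * X * Y ≡
      (+ 2 * (μ - λ′) * (a * a * C₁ - a * Δ) - + 2 * μ * κ) * ((C₁ - X) * (C₁ - Y))
        - κ * C₁ * (+ 2 * ((a - 1ℤ) * μ - a * λ′) + λ′) * (+ 2 * C₁ - X - Y) - + 2 * (μ - λ′) * C₁
    spec-id₂ = ℤRing.solve-∀

  *-positive : ∀ x y → Positive x → Positive y → Positive (x * y)
  *-positive (+ suc m) (+ suc n) _ _ = _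

  -- Degree sequences and sums of their products

  deg : Cube m → Fin m → ℤ
  deg h zero    = ∑ (upper h)
  deg h (suc i) = deg (lower h) i + deg (upper h) i

  sum-cong : ∀ {n} {s t : Fin n → ℤ} → (∀ i → s i ≡ t i) → sum s ≡ sum t
  sum-cong {zero}  e = refl
  sum-cong {suc n} e = cong₂ _+_ (e zero) (sum-cong (e ∘ suc))

  sum-zero : ∀ {n} {t : Fin n → ℤ} → (∀ i → t i ≡ 0ℤ) → sum t ≡ 0ℤ
  sum-zero {zero}  z = refl
  sum-zero {suc n} z = cong₂ _+_ (z zero) (sum-zero (z ∘ suc))

  sum-affine : ∀ {n} (a b : ℤ) (d : Fin n → ℤ) → sum (λ i → a * d i - b) ≡ a * sum d - + n * b
  sum-affine {zero}  a b d = sym (lem a b)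
    where
    lem : ∀ a b → a * 0ℤ - 0ℤ * b ≡ 0ℤ
    lem = ℤRing.solve-∀
  sum-affine {suc n} a b d = trans (cong (λ x → a * d zero - b + x) (sum-affine a b (d ∘ suc))) (lem a b (d zero) (sum (d ∘ suc)) (+ n))
    where
    lem : ∀ a b x s n → a * x - b + (a * s - n * b) ≡ a * (x + s) - (1ℤ + n) * b
    lem = ℤRing.solve-∀

  sum-affine-* : ∀ {n} (a b : ℤ) (d e : Fin n → ℤ) →
    sum (λ i → (a * d i - b) * e i) ≡ a * sum (λ i → d i * e i) - b * sum e
  sum-affine-* {zero}  a b d e = sym (lem a b)
    where
    lem : ∀ a b → a * 0ℤ - b * 0ℤ ≡ 0ℤ
    lem = ℤRing.solve-∀
  sum-affine-* {suc n} a b d e = trans (cong (λ x → (a * d zero - b) * e zero + x) (sum-affine-* a b (d ∘ suc) (e ∘ suc)))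
    (lem a b (d zero) (e zero) (sum (λ i → d (suc i) * e (suc i))) (sum (e ∘ suc)))
    where
    lem : ∀ a b x y s t → (a * x - b) * y + (a * s - b * t) ≡ a * (x * y + s) - b * (y + t)
    lem = ℤRing.solve-∀

  sum-shift : ∀ {n} (D : ℤ) (d e : Fin n → ℤ) → sum (λ i → d i * e i) ≡
    + n * D * D + D * ((sum d - + n * D) + (sum e - + n * D)) + sum (λ i → (d i - D) * (e i - D))
  sum-shift {zero} D d e = sym (lem D)
    where
    lem : ∀ D → 0ℤ * D * D + D * ((0ℤ - 0ℤ * D) + (0ℤ - 0ℤ * D)) + 0ℤ ≡ 0ℤ
    lem = ℤRing.solve-∀
  sum-shift {suc n} D d e = trans (cong (λ x → d zero * e zero + x) (sum-shift D (d ∘ suc) (e ∘ suc)))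
    (lem (+ n) D (d zero) (e zero) (sum (d ∘ suc)) (sum (e ∘ suc)) (sum (λ i → (d (suc i) - D) * (e (suc i) - D))))
    where
    lem : ∀ n D x y s t p → x * y + (n * D * D + D * ((s - n * D) + (t - n * D)) + p) ≡
      (1ℤ + n) * D * D + D * ((x + s - (1ℤ + n) * D) + (y + t - (1ℤ + n) * D)) + ((x - D) * (y - D) + p)
    lem = ℤRing.solve-∀

  sum-nonneg : ∀ {n} {e : Fin n → ℤ} → (∀ i → 1ℤ ≤ e i) → 0ℤ ≤ sum e
  sum-nonneg {zero}  p = ℤₚ.≤-refl
  sum-nonneg {suc n} p = +-nonneg (ℤₚ.≤-trans 0≤1 (p zero)) (sum-nonneg (p ∘ suc))

  sum-product : ∀ {n} (d e : Fin n → ℤ) → (∀ i → 1ℤ ≤ d i) → (∀ i → 1ℤ ≤ e i) →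
    0ℤ ≤ sum d * sum e - sum (λ i → d i * e i)
  sum-product {zero}  d e p q = ℤₚ.≤-refl
  sum-product {suc n} d e p q = subst (0ℤ ≤_) (lem (d zero) (e zero) (sum (d ∘ suc)) (sum (e ∘ suc)) (sum (λ i → d (suc i) * e (suc i))))
    (+-nonneg (+-nonneg (*-nonneg (ℤₚ.≤-trans 0≤1 (p zero)) (sum-nonneg (q ∘ suc))) (*-nonneg (sum-nonneg (p ∘ suc)) (ℤₚ.≤-trans 0≤1 (q zero))))
      (sum-product (d ∘ suc) (e ∘ suc) (p ∘ suc) (q ∘ suc)))
    where
    lem : ∀ x y s t r → x * t + s * y + (s * t - r) ≡ (x + s) * (y + t) - (x * y + r)
    lem = ℤRing.solve-∀

  -- The product of the sums exceeds the diagonal sum by the off-diagonal products `d i * e j`. Each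
  -- is at least one, and two indices guarantee that some exist. This excludes the tight case of
  -- excesses concentrated in one point.
  sum-product-strict : ∀ {n} (d e : Fin (suc (suc n)) → ℤ) → (∀ i → 1ℤ ≤ d i) → (∀ i → 1ℤ ≤ e i) →
    0ℤ ≤ sum d * sum e - sum (λ i → d i * e i) - 1ℤ
  sum-product-strict d e p q = subst (0ℤ ≤_) (lem (d zero) (e zero) (e (suc zero)) (sum (d ∘ suc)) (sum (λ i → e (suc (suc i)))) (sum (λ i → d (suc i) * e (suc i))))
    (+-nonneg (+-nonneg (+-nonneg (*-nonneg (ℤₚ.≤-trans 0≤1 (p zero)) (sum-nonneg (λ i → q (suc (suc i))))) (*-nonneg (sum-nonneg (p ∘ suc)) (ℤₚ.≤-trans 0≤1 (q zero))))
      (sum-product (d ∘ suc) (e ∘ suc) (p ∘ suc) (q ∘ suc)))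
      (+-nonneg (*-nonneg (ℤₚ.≤-trans 0≤1 (p zero)) (ℤₚ.i≤j⇒0≤j-i (q (suc zero)))) (ℤₚ.i≤j⇒0≤j-i (p zero))))
    where
    lem : ∀ x y z s t r → x * t + s * y + (s * (z + t) - r) + (x * (z - 1ℤ) + (x - 1ℤ)) ≡ (x + s) * (y + (z + t)) - (x * y + r) - 1ℤ
    lem = ℤRing.solve-∀

  ⟪⟫-lin : (h : Cube m) (γ : Fin m → ℤ) → ⟪ h , lin γ ⟫ ≡ sum (λ i → γ i * deg h i)
  ⟪⟫-lin {zero}  h γ = ℤₚ.*-zeroʳ (h [])
  ⟪⟫-lin {suc m} h γ = begin
    ⟪ lower h , lin γ′ ⟫ + ∑ (λ S → upper h S * (γ zero + lin γ′ S))
      ≡⟨ cong (λ x → ⟪ lower h , lin γ′ ⟫ + x) (trans (∑-cong (λ S → lem₀ (upper h S) (γ zero) (lin γ′ S)))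
           (∑-linear (γ zero) 1ℤ (upper h) (λ S → upper h S * lin γ′ S))) ⟩
    ⟪ lower h , lin γ′ ⟫ + (γ zero * ∑ (upper h) + 1ℤ * ⟪ upper h , lin γ′ ⟫)
      ≡⟨ cong₂ (λ x y → x + (γ zero * ∑ (upper h) + 1ℤ * y)) (⟪⟫-lin (lower h) γ′) (⟪⟫-lin (upper h) γ′) ⟩
    sum (λ i → γ′ i * deg (lower h) i) + (γ zero * ∑ (upper h) + 1ℤ * sum (λ i → γ′ i * deg (upper h) i))
      ≡⟨ lem₁ (sum (λ i → γ′ i * deg (lower h) i)) (γ zero * ∑ (upper h)) (sum (λ i → γ′ i * deg (upper h) i)) ⟩
    γ zero * ∑ (upper h) + (sum (λ i → γ′ i * deg (lower h) i) + sum (λ i → γ′ i * deg (upper h) i))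
      ≡⟨ cong (λ x → γ zero * ∑ (upper h) + x) (sum-distrib γ′ (deg (lower h)) (deg (upper h))) ⟩
    γ zero * ∑ (upper h) + sum (λ i → γ′ i * (deg (lower h) i + deg (upper h) i)) ∎
    where
    open ≡-Reasoning
    γ′ : Fin m → ℤ
    γ′ = γ ∘ suc
    lem₀ : ∀ h g l → h * (g + l) ≡ g * h + 1ℤ * (h * l)
    lem₀ = ℤRing.solve-∀
    lem₁ : ∀ a b c → a + (b + 1ℤ * c) ≡ b + (a + c)
    lem₁ = ℤRing.solve-∀
    sum-distrib : ∀ {n} (γ s t : Fin n → ℤ) → sum (λ i → γ i * s i) + sum (λ i → γ i * t i) ≡ sum (λ i → γ i * (s i + t i))
    sum-distrib {zero}  γ s t = refl
    sum-distrib {suc n} γ s t = trans (lem (γ zero) (s zero) (t zero) (sum (λ i → γ (suc i) * s (suc i))) (sum (λ i → γ (suc i) * t (suc i))))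
      (cong (λ x → γ zero * (s zero + t zero) + x) (sum-distrib (γ ∘ suc) (s ∘ suc) (t ∘ suc)))
      where
      lem : ∀ g s t x y → (g * s + x) + (g * t + y) ≡ g * (s + t) + (x + y)
      lem = ℤRing.solve-∀

  K-∅ : (h : Cube m) → K h ∅ ≡ ∑ h
  K-∅ {zero}  h = refl
  K-∅ {suc m} h = cong₂ _+_ (K-∅ (lower h)) (K-∅ (upper h))

  K-⁅⁆ : (h : Cube m) (i : Fin m) → K h ⁅ i ⁆ + deg h i ≡ ∑ h
  K-⁅⁆ h zero    = cong (_+ ∑ (upper h)) (K-∅ (lower h))
  K-⁅⁆ h (suc i) = trans (lem (K (lower h) ⁅ i ⁆) (K (upper h) ⁅ i ⁆) (deg (lower h) i) (deg (upper h) i))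
    (cong₂ _+_ (K-⁅⁆ (lower h) i) (K-⁅⁆ (upper h) i))
    where
    lem : ∀ a b c d → (a + b) + (c + d) ≡ (a + c) + (b + d)
    lem = ℤRing.solve-∀

  lin-1 : (S : Subset m) → lin (λ _ → 1ℤ) S ≡ size S
  lin-1 []            = refl
  lin-1 (outside ∷ S) = lin-1 S
  lin-1 (inside ∷ S)  = cong (λ x → 1ℤ + x) (lin-1 S)

  sum-deg : (r : ℤ) (h : Cube m) → IsLevel r h → sum (deg h) ≡ r * ∑ h
  sum-deg r h l = trans (sum-cong (λ i → sym (ℤₚ.*-identityˡ (deg h i)))) (trans (sym (⟪⟫-lin h (λ _ → 1ℤ)))
    (trans (∑-cong (λ S → trans (cong (λ x → h S * x) (lin-1 S)) (trans (ℤₚ.*-comm (h S) (size S)) (l S)))) (∑-* r h)))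

  lin-∁ : (γ : Fin m → ℤ) (S : Subset m) → lin γ S + lin γ (∁ S) ≡ sum γ
  lin-∁ γ []            = refl
  lin-∁ γ (outside ∷ S) = trans (lem (lin (γ ∘ suc) S) (γ zero) (lin (γ ∘ suc) (∁ S))) (cong (λ x → γ zero + x) (lin-∁ (γ ∘ suc) S))
    where
    lem : ∀ a b c → a + (b + c) ≡ b + (a + c)
    lem = ℤRing.solve-∀
  lin-∁ γ (inside ∷ S)  = trans (ℤₚ.+-assoc (γ zero) (lin (γ ∘ suc) S) (lin (γ ∘ suc) (∁ S))) (cong (λ x → γ zero + x) (lin-∁ (γ ∘ suc) S))

  lin-⁅⁆ : (γ : Fin m → ℤ) (i : Fin m) → lin γ ⁅ i ⁆ ≡ γ i
  lin-⁅⁆ {suc m} γ zero = trans (cong (λ x → γ zero + x) (lin-empty (γ ∘ suc) ∅ (∣⊥∣≡0 m))) (ℤₚ.+-identityʳ (γ zero))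
  lin-⁅⁆ γ (suc i) = lin-⁅⁆ (γ ∘ suc) i

  level-lev : (a : ℕ) (h : Cube m) → IsLevel (+ a) h → ∀ S → h S * lev a S ≡ h S
  level-lev a h l S with ∣ S ∣ ℕ.≟ a
  ... | yes e = trans (cong (λ x → h S * x) (lev-1 S e)) (ℤₚ.*-identityʳ (h S))
  ... | no ≢a = trans (cong (_* lev a S) (level⇒zero l S ≢a)) (sym (level⇒zero l S ≢a))

  lev-nonneg : (a : ℕ) (S : Subset m) → 0ℤ ≤ lev a S
  lev-nonneg a S with ∣ S ∣ ℕ.≟ a
  ... | yes e = subst (0ℤ ≤_) (sym (lev-1 S e)) 0≤1
  ... | no ≢a = ℤₚ.≤-reflexive (sym (lev-zero S ≢a))

  -- The spectral inequality for a cross-intersecting pair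

  -- Sets of size a = α + 2 in a ground set of size M = n + 2 = 2a + 1 + q.  Up to sign, μ and λ′ are the eigenvalues
  -- of K on the harmonics of degree 1 and 2; κ, Δ, C₁ stand for C(M−2, a−1), C(M−2, a−2), C(M−1, a−1).
  module Spectrum (α q n : ℕ) (n≡ : n ≡ α ℕ.+ (suc q ℕ.+ α) ℕ.+ 2) where

    -- Chosen so that the complement of an `a`-set has `p + 2` points.
    p : ℕ
    p = suc q ℕ.+ α

    M : ℕ
    M = suc (suc n)

    a : ℕ
    a = suc (suc α)

    κ Δ C₁ c μ λ′ : ℤ
    κ  = + (n C suc α)
    Δ  = + (n C α)
    C₁ = κ + Δ
    c  = κ * C₁
    μ  = + (suc p C suc α)
    λ′ = + (p C α)

    pascal : + (suc n C suc α) ≡ C₁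
    pascal = trans (cong +_ (sym (nCk+nC[k+1]≡[n+1]C[k+1] n α))) (ℤₚ.+-comm Δ κ)

    choose-positive′ : ∀ {N} i j → N ≡ i ℕ.+ j → ℕ.NonZero (N C i)
    choose-positive′ i j refl = choose-positive i j

    positive : ∀ k → ℕ.NonZero k → Positive (+ k)
    positive (suc k) _ = _

    κ-positive : Positive κ
    κ-positive = positive (n C suc α) (choose-positive′ (suc α) (suc p) (trans n≡ (lem α p)))
      where
      lem : ∀ α p → α ℕ.+ p ℕ.+ 2 ≡ suc α ℕ.+ suc p
      lem = ℕRing.solve-∀

    C₁-positive : Positive C₁
    C₁-positive = ℤ.positive (ℤₚ.<-≤-trans (ℤₚ.positive⁻¹ κ {{κ-positive}}) (ℤₚ.i≤i+j κ Δ))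

    1≤C₁ : 1ℤ ≤ C₁
    1≤C₁ = ℤₚ.i<j⇒suc[i]≤j (ℤₚ.positive⁻¹ C₁ {{C₁-positive}})

    c-positive : Positive c
    c-positive = *-positive κ C₁ κ-positive C₁-positive

    μ≡ : μ ≡ λ′ + + (p C suc α)
    μ≡ = cong +_ (sym (nCk+nC[k+1]≡[n+1]C[k+1] p α))

    1≤μ-λ : 1ℤ ≤ μ - λ′
    1≤μ-λ = subst (1ℤ ≤_) (trans (lem λ′ (+ (p C suc α))) (cong (_- λ′) (sym μ≡)))
      (ℤₚ.i<j⇒suc[i]≤j (ℤₚ.positive⁻¹ _ {{positive (p C suc α) (choose-positive′ (suc α) q (ℕₚ.+-comm (suc q) α ⟨ trans ⟩ ℕₚ.+-suc α q))}}))
      where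
      lem : ∀ x y → y ≡ (x + y) - x
      lem = ℤRing.solve-∀

    μ-positive : Positive μ
    μ-positive = positive (suc p C suc α) (choose-positive′ (suc α) (suc q) (cong suc (ℕₚ.+-comm (suc q) α)))

    -- The difference equals `q * λ′`, because `suc p * λ′ = suc α * μ` and `suc p = a + q`. It is
    -- nonnegative because the ground set has at least `2a + 1` points.
    gap : 0ℤ ≤ (+ a - 1ℤ) * μ - + a * λ′
    gap = subst (0ℤ ≤_) (trans (lem₁ (+ q) (+ α) λ′) (trans (cong (_- + a * λ′) absorb) (lem₂ (+ α) μ λ′)))
      (*-nonneg (+≤+ {0} {q} ℕ.z≤n) (+≤+ {0} {p C α} ℕ.z≤n))
      where
      absorb : + suc p * λ′ ≡ + suc α * μ
      absorb = trans (sym (ℤₚ.pos-* (suc p) (p C α))) (trans (cong +_ (absorption p α)) (ℤₚ.pos-* (suc α) (suc p C suc α)))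
      lem₁ : ∀ q α x → q * x ≡ (1ℤ + (1ℤ + q + α)) * x - (1ℤ + (1ℤ + α)) * x
      lem₁ = ℤRing.solve-∀
      lem₂ : ∀ α μ x → (1ℤ + α) * μ - (1ℤ + (1ℤ + α)) * x ≡ (1ℤ + (1ℤ + α) - 1ℤ) * μ - (1ℤ + (1ℤ + α)) * x
      lem₂ = ℤRing.solve-∀

    -- Count degrees in a full star: `C₁` at the centre and `Δ` at the other `M - 1` points give
    -- `a * C₁ = C₁ + (M - 1) * Δ`, and `C₁ - κ = Δ`.
    W≡ : + a * C₁ - κ ≡ + M * Δ
    W≡ = trans (lem (+ suc α) κ Δ) (trans (cong (_+ Δ) (trans (cong (λ x → + suc α * x) (sym pascal))
      (trans (sym (ℤₚ.pos-* (suc α) (suc n C suc α))) (trans (cong +_ (sym (absorption n α))) (ℤₚ.pos-* (suc n) (n C α))))))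
      (lem′ (+ suc n) Δ))
      where
      lem : ∀ a κ Δ → (1ℤ + a) * (κ + Δ) - κ ≡ a * (κ + Δ) + Δ
      lem = ℤRing.solve-∀
      lem′ : ∀ n Δ → n * Δ + Δ ≡ (1ℤ + n) * Δ
      lem′ = ℤRing.solve-∀

    L : (Fin M → ℤ) → Cube M
    L γ S = lev a S * lin γ S

    L-level : ∀ γ → IsLevel (+ a) (L γ)
    L-level γ S = trans (lem (size S) (lev a S) (lin γ S)) (trans (cong (_* lin γ S) (lev-size a S)) (lem′ (lev a S) (+ a) (lin γ S)))
      where
      lem : ∀ s v l → s * (v * l) ≡ (v * s) * l
      lem = ℤRing.solve-∀
      lem′ : ∀ v a l → (v * a) * l ≡ a * (v * l)
      lem′ = ℤRing.solve-∀

    ⟪⟫-L : (h : Cube M) → IsLevel (+ a) h → ∀ γ → ⟪ h , L γ ⟫ ≡ ⟪ h , lin γ ⟫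
    ⟪⟫-L h l γ = ∑-cong λ S → trans (sym (ℤₚ.*-assoc (h S) (lev a S) (lin γ S))) (cong (_* lin γ S) (level-lev a h l S))

    ∑-L : ∀ γ → ∑ (L γ) ≡ C₁ * sum γ
    ∑-L γ = trans (sym (K-∅ (L γ))) (trans (ζ-lev-lin (suc α) γ (∁ ∅)) (cong₂ _*_
      (trans (cong (λ k → + (ℕ.pred k C suc α)) (trans (∣∁p∣≡n∸∣p∣ {M} ∅) (cong (M ℕ.∸_) (∣⊥∣≡0 M)))) pascal)
      (trans (sym (ℤₚ.+-identityˡ (lin γ (∁ ∅)))) (trans (cong (_+ lin γ (∁ ∅)) (sym (lin-empty γ ∅ (∣⊥∣≡0 M)))) (lin-∁ γ ∅)))))

    lin-∁′ : (γ : Fin M → ℤ) (S : Subset M) → lin γ (∁ S) ≡ sum γ - lin γ S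
    lin-∁′ γ S = trans (lem (lin γ S) (lin γ (∁ S))) (cong (_- lin γ S) (lin-∁ γ S))
      where
      lem : ∀ x y → y ≡ (x + y) - x
      lem = ℤRing.solve-∀

    K-L-⁅⁆ : ∀ γ i → K (L γ) ⁅ i ⁆ ≡ κ * (sum γ - γ i)
    K-L-⁅⁆ γ i = trans (ζ-lev-lin (suc α) γ (∁ ⁅ i ⁆)) (cong₂ _*_
      (cong (λ k → + (ℕ.pred k C suc α)) (trans (∣∁p∣≡n∸∣p∣ ⁅ i ⁆) (cong (M ℕ.∸_) (∣⁅x⁆∣≡1 i))))
      (trans (lin-∁′ γ ⁅ i ⁆) (cong (λ x → sum γ - x) (lin-⁅⁆ γ i))))

    ∣∁∣ : (S : Subset M) → ∣ S ∣ ≡ a → ∣ ∁ S ∣ ≡ suc (suc p)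
    ∣∁∣ S e = trans (∣∁p∣≡n∸∣p∣ S) (trans (cong₂ ℕ._∸_ (cong {A = ℕ} (λ k → suc (suc k)) n≡) e)
      (trans (cong (λ x → suc (suc x) ℕ.∸ a) (lem α p)) (ℕₚ.m+n∸m≡n a (suc (suc p)))))
      where
      lem : ∀ α p → α ℕ.+ p ℕ.+ 2 ≡ α ℕ.+ suc (suc p)
      lem = ℕRing.solve-∀

    -- The complement of an `a`-set has `p + 2` points, each in `μ` of its `a`-subsets; so on level
    -- `a` the function `K (L γ)` is again affine, with linear part `- μ * lin γ`.
    K-L : (g : Cube M) → IsLevel (+ a) g → ∀ γ → ⟪ g , K (L γ) ⟫ ≡ μ * (sum γ * ∑ g - ⟪ g , lin γ ⟫)
    K-L g l γ = trans (∑-cong pt) (trans (∑-linear (μ * sum γ) (- μ) g (λ S → g S * lin γ S)) (fold μ (sum γ) (∑ g) ⟪ g , lin γ ⟫))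
      where
      fold : ∀ μ s x y → μ * s * x + - μ * y ≡ μ * (s * x - y)
      fold = ℤRing.solve-∀
      zero-id : ∀ k x y → 0ℤ * k ≡ x * 0ℤ + y * 0ℤ
      zero-id = ℤRing.solve-∀
      expand : ∀ g μ s x → g * (μ * (s - x)) ≡ μ * s * g + - μ * (g * x)
      expand = ℤRing.solve-∀
      pt : ∀ S → g S * K (L γ) S ≡ μ * sum γ * g S + - μ * (g S * lin γ S)
      pt S with ∣ S ∣ ℕ.≟ a
      ... | yes e = trans (cong (λ x → g S * x) (trans (ζ-lev-lin (suc α) γ (∁ S)) (cong₂ _*_
              (cong (λ k → + (ℕ.pred k C suc α)) (∣∁∣ S e)) (lin-∁′ γ S)))) (expand (g S) μ (sum γ) (lin γ S))
      ... | no ≢a = trans (cong (_* K (L γ) S) g≡0) (trans (zero-id (K (L γ) S) (μ * sum γ) (- μ))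
              (cong₂ (λ x y → μ * sum γ * x + - μ * y) (sym g≡0) (trans (sym (ℤₚ.*-zeroˡ (lin γ S))) (cong (_* lin γ S) (sym g≡0)))))
        where g≡0 = level⇒zero l S ≢a

    -- c times the projection of f to the orthogonal complement of the linear functions.
    module Projection (f : Cube M) (level : IsLevel (+ a) f) (idem : ∀ S → f S * f S ≡ f S) where

      X : ℤ
      X = ∑ f

      -- Solves the normal equations: the degree of `L γ` at `i` is `κ * γ i + Δ * sum γ`, and this
      -- choice makes it `c * deg f i`, since `sum γ` is `κ * X`. Clearing denominators in the
      -- solution is what produces the scale `c = κ * C₁`.
      γ : Fin M → ℤ
      γ i = C₁ * deg f i - Δ * X

      f̂ : Cube M
      f̂ S = c * f S + - 1ℤ * L γ S

      sum-γ : sum γ ≡ κ * X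
      sum-γ = trans (sum-affine C₁ (Δ * X) (deg f)) (trans (cong (λ x → C₁ * x - + M * (Δ * X)) (sum-deg (+ a) f level))
        (trans (lem (+ a) C₁ κ X (+ M) Δ) (trans (cong (λ x → κ * X + (x - + M * Δ) * X) W≡) (lem′ (κ * X) (+ M * Δ) X))))
        where
        lem : ∀ a C₁ κ X M Δ → C₁ * (a * X) - M * (Δ * X) ≡ κ * X + ((a * C₁ - κ) - M * Δ) * X
        lem = ℤRing.solve-∀
        lem′ : ∀ x y X → x + (y - y) * X ≡ x
        lem′ = ℤRing.solve-∀

      f̂-level : IsLevel (+ a) f̂
      f̂-level S = trans (lem (size S) c (f S) (L γ S)) (trans (cong₂ (λ x y → c * x + - 1ℤ * y) (level S) (L-level γ S)) (sym (lem (+ a) c (f S) (L γ S))))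
        where
        lem : ∀ s c x y → s * (c * x + - 1ℤ * y) ≡ c * (s * x) + - 1ℤ * (s * y)
        lem = ℤRing.solve-∀

      ∑-f̂ : ∑ f̂ ≡ 0ℤ
      ∑-f̂ = trans (∑-linear c (- 1ℤ) f (L γ)) (trans (cong (λ x → c * X + - 1ℤ * x) (trans (∑-L γ) (cong (λ x → C₁ * x) sum-γ))) (lem κ C₁ X))
        where
        lem : ∀ κ C₁ X → κ * C₁ * X + - 1ℤ * (C₁ * (κ * X)) ≡ 0ℤ
        lem = ℤRing.solve-∀

      -- The degree at `i` is the total minus the sum over sets avoiding `i`. The latter is `K` at a
      -- singleton, where `K-L-⁅⁆` evaluates the linear part.
      deg-f̂ : ∀ i → deg f̂ i ≡ 0ℤ
      deg-f̂ i = trans (sym (ℤₚ.+-identityˡ (deg f̂ i))) (trans (cong (_+ deg f̂ i) (sym K≡0)) (trans (K-⁅⁆ f̂ i) ∑-f̂))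
        where
        add-sub : ∀ x y → x ≡ (x + y) - y
        add-sub = ℤRing.solve-∀
        lem : ∀ κ Δ X d → κ * (κ + Δ) * (X - d) + - 1ℤ * (κ * (κ * X - ((κ + Δ) * d - Δ * X))) ≡ 0ℤ
        lem = ℤRing.solve-∀
        K≡0 : K f̂ ⁅ i ⁆ ≡ 0ℤ
        K≡0 = trans (ζ-linear c (- 1ℤ) f (L γ) (∁ ⁅ i ⁆)) (trans (cong₂ (λ x y → c * x + - 1ℤ * y)
          (trans (add-sub (K f ⁅ i ⁆) (deg f i)) (cong (_- deg f i) (K-⁅⁆ f i)))
          (trans (K-L-⁅⁆ γ i) (cong (λ x → κ * (x - γ i)) sum-γ))) (lem κ Δ X (deg f i)))

      f̂-centered : Centered f̂
      f̂-centered = centered ∑-f̂ λ γ′ → trans (⟪⟫-lin f̂ γ′)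
        (sum-zero (λ i → trans (cong (λ x → γ′ i * x) (deg-f̂ i)) (ℤₚ.*-zeroʳ (γ′ i))))

      L-lin : ∀ γ′ → ⟪ L γ , lin γ′ ⟫ ≡ c * ⟪ f , lin γ′ ⟫
      L-lin γ′ = trans (lem c ⟪ f , lin γ′ ⟫ ⟪ L γ , lin γ′ ⟫)
        (trans (cong (λ x → c * ⟪ f , lin γ′ ⟫ - x) (trans (sym (⟪⟫-linearˡ c (- 1ℤ) f (L γ) (lin γ′))) (Centered.lin⊥ f̂-centered γ′))) (lem′ (c * ⟪ f , lin γ′ ⟫)))
        where
        lem : ∀ c x y → y ≡ c * x - (c * x + - 1ℤ * y)
        lem = ℤRing.solve-∀
        lem′ : ∀ x → x - 0ℤ ≡ x
        lem′ = ℤRing.solve-∀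

      -- Pythagoras: `L γ` is orthogonal to `f̂`, and a 0-1 valued `f` has squared norm `X`.
      norm-f̂ : ‖ f̂ ‖² ≡ c * (c * X - ⟪ f , lin γ ⟫)
      norm-f̂ = trans (⟪⟫-linearʳ f̂ c (- 1ℤ) f (L γ)) (trans (cong₂ (λ x y → c * x + - 1ℤ * y)
        (trans (⟪⟫-linearˡ c (- 1ℤ) f (L γ) f) (cong₂ (λ x y → c * x + - 1ℤ * y) (∑-cong idem) (trans (⟪⟫-comm (L γ) f) (⟪⟫-L f level γ))))
        (trans (⟪⟫-L f̂ f̂-level γ) (Centered.lin⊥ f̂-centered γ))) (lem c X ⟪ f , lin γ ⟫))
        where
        lem : ∀ c X y → c * (c * X + - 1ℤ * y) + - 1ℤ * 0ℤ ≡ c * (c * X - y)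
        lem = ℤRing.solve-∀

    module Pair (f g : Cube M) (f-level : IsLevel (+ a) f) (g-level : IsLevel (+ a) g)
                (f-idem : ∀ S → f S * f S ≡ f S) (g-idem : ∀ S → g S * g S ≡ g S)
                (cross : ⟪ f , K g ⟫ ≡ 0ℤ) where

      module F = Projection f f-level f-idem
      module G = Projection g g-level g-idem
      open F using (X; f̂; γ)
      open G using () renaming (X to Y; f̂ to ĝ; γ to δ)

      Q : ℤ
      Q = ⟪ f , lin δ ⟫

      -- The part `L γ` contributes nothing, since `K (L γ)` is affine on level `a` and `ĝ` is
      -- centered. In `⟪ f , K ĝ ⟫` the term with `K g` vanishes by `cross`, which leaves only the
      -- linear part of `g`.
      cross-projection : ⟪ f̂ , K ĝ ⟫ ≡ - (c * (μ * (κ * X * Y - Q)))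
      cross-projection = trans (⟪⟫-linearˡ c (- 1ℤ) f (L γ) (K ĝ)) (trans (cong₂ (λ x y → c * x + - 1ℤ * y)
        (trans (∑-cong (λ S → cong (λ x → f S * x) (ζ-linear c (- 1ℤ) g (L δ) (∁ S))))
          (trans (⟪⟫-linearʳ f c (- 1ℤ) (K g) (K (L δ))) (cong₂ (λ x y → c * x + - 1ℤ * y) cross
            (trans (K-L f f-level δ) (cong (λ x → μ * (x * X - Q)) G.sum-γ)))))
        (trans (K-selfAdjoint (L γ) ĝ) (trans (⟪⟫-comm (K (L γ)) ĝ) (trans (K-L ĝ G.f̂-level γ)
          (cong₂ (λ x y → μ * (sum γ * x - y)) G.∑-f̂ (Centered.lin⊥ G.f̂-centered γ))))))
        (lem c μ κ X Y Q (sum γ)))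
        where
        lem : ∀ c μ κ X Y Q s → c * (c * 0ℤ + - 1ℤ * (μ * (κ * Y * X - Q))) + - 1ℤ * (μ * (s * 0ℤ - 0ℤ)) ≡ - (c * (μ * (κ * X * Y - Q)))
        lem = ℤRing.solve-∀

      -- Times `c`, this is the squared distance between the linear parts `L γ` and `L δ`. It later
      -- trades the two individual linear terms for the mixed term `Q`.
      lin-distance : 0ℤ ≤ ⟪ f , lin γ ⟫ - + 2 * Q + ⟪ g , lin δ ⟫
      lin-distance = ℤₚ.*-cancelˡ-≤-pos 0ℤ (⟪ f , lin γ ⟫ - + 2 * Q + ⟪ g , lin δ ⟫) c {{c-positive}}
        (subst₂ _≤_ (sym (ℤₚ.*-zeroʳ c)) expand
          (∑-nonneg (λ S → *-nonneg (lev-nonneg a S) (sq-nonneg (lin γ S - lin δ S)))))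
        where
        pt : ∀ v x y → v * ((x - y) * (x - y)) ≡ 1ℤ * (v * x * x + - (+ 2) * (v * x * y)) + 1ℤ * (v * y * y)
        pt = ℤRing.solve-∀
        fold : ∀ c x y z → 1ℤ * (c * x + - (+ 2) * (c * y)) + 1ℤ * (c * z) ≡ c * (x - + 2 * y + z)
        fold = ℤRing.solve-∀
        expand : ∑ (λ S → lev a S * ((lin γ S - lin δ S) * (lin γ S - lin δ S))) ≡ c * (⟪ f , lin γ ⟫ - + 2 * Q + ⟪ g , lin δ ⟫)
        expand = trans (∑-cong (λ S → pt (lev a S) (lin γ S) (lin δ S)))
          (trans (∑-linear 1ℤ 1ℤ (λ S → L γ S * lin γ S + - (+ 2) * (L γ S * lin δ S)) (λ S → L δ S * lin δ S))
          (trans (cong₂ (λ x y → 1ℤ * x + 1ℤ * y)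
            (trans (∑-+ (λ S → L γ S * lin γ S) (λ S → - (+ 2) * (L γ S * lin δ S)))
              (cong₂ _+_ (F.L-lin γ) (trans (∑-* (- (+ 2)) (λ S → L γ S * lin δ S)) (cong (λ x → - (+ 2) * x) (F.L-lin δ)))))
            (G.L-lin δ))
          (fold c ⟪ f , lin γ ⟫ Q ⟪ g , lin δ ⟫)))

      -- Expand the norm of `P * f̂ + A * k`, where `k` is `ĝ` raised `l` times and read at
      -- complements. The raising bound replaces `A * A * ‖ k ‖²` by `P * P * ‖ ĝ ‖²`, and the mixed
      -- term is `I * ⟪ f̂ , K ĝ ⟫`. Dividing by `P * (A * I)` leaves the ratio of `P` to `A * I`,
      -- which is the binomial coefficient `λ′`.
      cauchy-schwarz : 0ℤ ≤ λ′ * (‖ f̂ ‖² + ‖ ĝ ‖²) + + 2 * ⟪ f̂ , K ĝ ⟫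
      cauchy-schwarz = ℤₚ.*-cancelˡ-≤-pos 0ℤ _ (P * (A * I)) {{scale-positive}} (subst (_≤ P * (A * I) * (λ′ * (‖ f̂ ‖² + ‖ ĝ ‖²) + + 2 * ⟪ f̂ , K ĝ ⟫)) (sym (ℤₚ.*-zeroʳ (P * (A * I))))
        (subst (0ℤ ≤_) expand (+-nonneg (norm-nonneg (λ S → P * f̂ S + A * k S)) (ℤₚ.i≤j⇒0≤j-i k-bound))))
        where
        -- The number of raising steps from size `a` to the size `p + 2` of the complement of an
        -- `a`-set.
        l = suc q
        A = + (α !)
        P = + (p !)
        I = + (l !)
        k : Cube M
        k S = U^ l ĝ (∁ S)
        scale-positive : Positive (P * (A * I))
        scale-positive = *-positive P (A * I) (pos p) (*-positive A I (pos α) (pos l))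
          where
          pos : ∀ j → Positive (+ (j !))
          pos j with j ! | j ℕₚ.!≢0
          ... | suc _ | _ = _
        P≡ : P ≡ λ′ * (A * I)
        P≡ = trans (cong +_ (sym (trans (cong (λ x → (x C α) ℕ.* (α ! ℕ.* l !)) (ℕₚ.+-comm l α)) (trans (choose-factorial α l) (cong _! (ℕₚ.+-comm α l))))))
          (trans (ℤₚ.pos-* (p C α) (α ! ℕ.* l !)) (cong (λ x → λ′ * x) (ℤₚ.pos-* (α !) (l !))))
        M≡ : M ≡ α ℕ.+ p ℕ.+ 4
        M≡ = trans (cong {A = ℕ} (λ x → suc (suc x)) n≡) (lem α p)
          where
          lem : ∀ α p → suc (suc (α ℕ.+ p ℕ.+ 2)) ≡ α ℕ.+ p ℕ.+ 4
          lem = ℕRing.solve-∀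
        k-norm : ‖ k ‖² ≡ ‖ U^ l ĝ ‖²
        k-norm = ∑-∁ (λ S → U^ l ĝ S * U^ l ĝ S)
        k-bound : A * A * ‖ k ‖² ≤ P * P * ‖ ĝ ‖²
        k-bound = subst (λ x → A * A * x ≤ P * P * ‖ ĝ ‖²) (sym k-norm) (U^-bound {α = α} {p} ĝ M≡ G.f̂-level G.f̂-centered l α refl)
        k-K : ∀ S → f̂ S * k S ≡ I * (f̂ S * K ĝ S)
        k-K S with ∣ S ∣ ℕ.≟ a
        ... | yes e = trans (cong (λ x → f̂ S * x) (trans (U^-ζ a ĝ G.f̂-level l (∁ S))
                (cong (λ x → I * (x * K ĝ S)) (lev-1 (∁ S) (trans (∣∁∣ S e) (lem l α)))))) (lem′ (f̂ S) I (K ĝ S))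
          where
          lem : ∀ l α → suc (suc (l ℕ.+ α)) ≡ l ℕ.+ suc (suc α)
          lem = ℕRing.solve-∀
          lem′ : ∀ f i k → f * (i * (1ℤ * k)) ≡ i * (f * k)
          lem′ = ℤRing.solve-∀
        ... | no ≢a = trans (cong (_* k S) f≡0) (trans (lem (k S) I (K ĝ S)) (cong (λ x → I * (x * K ĝ S)) (sym f≡0)))
          where
          f≡0 = level⇒zero F.f̂-level S ≢a
          lem : ∀ k i z → 0ℤ * k ≡ i * (0ℤ * z)
          lem = ℤRing.solve-∀
        ⟪f̂,k⟫ : ⟪ f̂ , k ⟫ ≡ I * ⟪ f̂ , K ĝ ⟫
        ⟪f̂,k⟫ = trans (∑-cong k-K) (∑-* I (λ S → f̂ S * K ĝ S))
        lem₁ : ∀ P A I x z w y → P * P * x + (P * A + P * A) * (I * w) + A * A * y + (P * P * z - A * A * y) ≡ P * (P * (x + z) + + 2 * (A * I) * w)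
        lem₁ = ℤRing.solve-∀
        lem₂ : ∀ P t r x w → P * (r * t * x + + 2 * t * w) ≡ P * t * (r * x + + 2 * w)
        lem₂ = ℤRing.solve-∀
        expand : ‖ (λ S → P * f̂ S + A * k S) ‖² + (P * P * ‖ ĝ ‖² - A * A * ‖ k ‖²) ≡ P * (A * I) * (λ′ * (‖ f̂ ‖² + ‖ ĝ ‖²) + + 2 * ⟪ f̂ , K ĝ ⟫)
        expand = trans (cong (_+ (P * P * ‖ ĝ ‖² - A * A * ‖ k ‖²)) (trans (norm-linear P A f̂ k)
            (cong (λ x → P * P * ‖ f̂ ‖² + (P * A + P * A) * x + A * A * ‖ k ‖²) ⟪f̂,k⟫)))
          (trans (lem₁ P A I ‖ f̂ ‖² ‖ ĝ ‖² ⟪ f̂ , K ĝ ⟫ ‖ k ‖²)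
          (trans (cong (λ x → P * (x * (‖ f̂ ‖² + ‖ ĝ ‖²) + + 2 * (A * I) * ⟪ f̂ , K ĝ ⟫)) P≡)
            (lem₂ P (A * I) λ′ (‖ f̂ ‖² + ‖ ĝ ‖²) ⟪ f̂ , K ĝ ⟫)))

      cancel-c : ∀ x → 0ℤ ≤ c * x → 0ℤ ≤ x
      cancel-c x p = ℤₚ.*-cancelˡ-≤-pos 0ℤ x c {{c-positive}} (subst (_≤ c * x) (sym (ℤₚ.*-zeroʳ c)) p)

      -- Nonnegativity of `‖ f̂ ‖²` and `‖ ĝ ‖²` bounds each linear term by `c` times the size, and
      -- `lin-distance` bounds `2 * Q` by the sum of the linear terms.
      norms : 0ℤ ≤ c * (X + Y) - + 2 * Q
      norms = subst (0ℤ ≤_) (lem c X Y Q ⟪ f , lin γ ⟫ ⟪ g , lin δ ⟫)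
        (+-nonneg (+-nonneg (cancel-c (c * X - ⟪ f , lin γ ⟫) (subst (0ℤ ≤_) F.norm-f̂ (norm-nonneg f̂)))
          (cancel-c (c * Y - ⟪ g , lin δ ⟫) (subst (0ℤ ≤_) G.norm-f̂ (norm-nonneg ĝ)))) lin-distance)
        where
        lem : ∀ c X Y Q x y → (c * X - x) + (c * Y - y) + (x - + 2 * Q + y) ≡ c * (X + Y) - + 2 * Q
        lem = ℤRing.solve-∀

      -- After division by `c`, the individual linear terms enter `cauchy-schwarz` with coefficient
      -- `- λ′`; adding `λ′` times `lin-distance` replaces them by `Q`.
      spectral : 0ℤ ≤ + 2 * (μ - λ′) * Q + λ′ * c * (X + Y) - + 2 * μ * κ * X * Y
      spectral = subst (0ℤ ≤_) (lem₂ c λ′ μ κ X Y Q ⟪ f , lin γ ⟫ ⟪ g , lin δ ⟫) (+-nonneg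
        (cancel-c (λ′ * ((c * X - ⟪ f , lin γ ⟫) + (c * Y - ⟪ g , lin δ ⟫)) - + 2 * (μ * (κ * X * Y - Q)))
          (subst (0ℤ ≤_) (trans (cong₂ (λ x y → λ′ * x + + 2 * y) (cong₂ _+_ F.norm-f̂ G.norm-f̂) cross-projection)
            (lem₁ c λ′ (c * X - ⟪ f , lin γ ⟫) (c * Y - ⟪ g , lin δ ⟫) (μ * (κ * X * Y - Q)))) cauchy-schwarz))
        (*-nonneg (+≤+ {0} {p C α} ℕ.z≤n) lin-distance))
        where
        lem₁ : ∀ c r x y w → r * (c * x + c * y) + + 2 * - (c * w) ≡ c * (r * (x + y) - + 2 * w)
        lem₁ = ℤRing.solve-∀
        lem₂ : ∀ c r μ κ X Y Q x y → (r * ((c * X - x) + (c * Y - y)) - + 2 * (μ * (κ * X * Y - Q))) + r * (x - + 2 * Q + y) ≡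
          + 2 * (μ - r) * Q + r * c * (X + Y) - + 2 * μ * κ * X * Y
        lem₂ = ℤRing.solve-∀

      -- Eliminate `Q` from `spectral` by means of `norms`. For positive sizes the result bounds the
      -- harmonic mean of `X` and `Y` by `C₁`, an Erdős-Ko-Rado bound for the pair.
      harmonic : 0ℤ ≤ C₁ * (X + Y) - + 2 * X * Y
      harmonic = ℤₚ.*-cancelˡ-≤-pos 0ℤ _ (μ * κ) {{*-positive μ κ μ-positive κ-positive}}
        (subst (_≤ μ * κ * (C₁ * (X + Y) - + 2 * X * Y)) (sym (ℤₚ.*-zeroʳ (μ * κ)))
          (subst (0ℤ ≤_) (lem μ λ′ κ C₁ X Y Q) (+-nonneg spectral (*-nonneg (ℤₚ.≤-trans 0≤1 1≤μ-λ) norms))))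
        where
        lem : ∀ μ r κ C₁ X Y Q → (+ 2 * (μ - r) * Q + r * (κ * C₁) * (X + Y) - + 2 * μ * κ * X * Y) + (μ - r) * (κ * C₁ * (X + Y) - + 2 * Q) ≡
          μ * κ * (C₁ * (X + Y) - + 2 * X * Y)
        lem = ℤRing.solve-∀

      -- The excesses over `Δ` are all at least one and their sums are fixed by the sizes. This
      -- limits the sum of the products of the degrees from above, while `spectral`, with `Q`
      -- rewritten by `Q≡`, limits it from below.
      no-large-degrees : (∀ i → 1ℤ + Δ ≤ deg f i) → (∀ i → 1ℤ + Δ ≤ deg g i) → ⊥
      no-large-degrees df dg = spectral-contradiction (+ a) κ Δ μ λ′ X Y Σde (+≤+ (ℕ.s≤s ℕ.z≤n))
        (+≤+ ℕ.z≤n) (subst (0ℤ ≤_) (trans (ℤₚ.pos-* M (n C α)) (sym W≡)) (+≤+ ℕ.z≤n)) 1≤C₁ (+≤+ ℕ.z≤n) 1≤μ-λ gap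
        (E≥0 f f-level df) (E≥0 g g-level dg) product-bound
        (subst (λ x → 0ℤ ≤ + 2 * (μ - λ′) * x + λ′ * κ * C₁ * (X + Y) - + 2 * μ * κ * X * Y) Q≡
          (subst (λ x → 0ℤ ≤ + 2 * (μ - λ′) * Q + x * (X + Y) - + 2 * μ * κ * X * Y) (sym (ℤₚ.*-assoc λ′ κ C₁)) spectral))
        harmonic
        where
        d = deg f
        e = deg g
        Σde = sum (λ i → d i * e i)
        W = + a * C₁ - κ
        ≥1 : ∀ {x} → 1ℤ + Δ ≤ x → 1ℤ ≤ 1ℤ * x - Δ
        ≥1 {x} p = ℤₚ.0≤i-j⇒j≤i (subst (0ℤ ≤_) (lem x Δ) (ℤₚ.i≤j⇒0≤j-i p))
          where
          lem : ∀ x y → x - (1ℤ + y) ≡ (1ℤ * x - y) - 1ℤ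
          lem = ℤRing.solve-∀
        excess : ∀ h → IsLevel (+ a) h → sum (λ i → 1ℤ * deg h i - Δ) ≡ + a * ∑ h - W
        excess h l = trans (sum-affine 1ℤ Δ (deg h)) (cong₂ _-_ (trans (ℤₚ.*-identityˡ (sum (deg h))) (sum-deg (+ a) h l)) (sym W≡))
        E≥0 : ∀ h → IsLevel (+ a) h → (∀ i → 1ℤ + Δ ≤ deg h i) → 0ℤ ≤ + a * ∑ h - W
        E≥0 h l p = subst (0ℤ ≤_) (excess h l) (sum-nonneg (λ i → ≥1 (p i)))
        Q≡ : Q ≡ C₁ * Σde - + a * Δ * X * Y
        Q≡ = trans (⟪⟫-lin f δ) (trans (sum-affine-* C₁ (Δ * Y) e d) (cong₂ (λ x y → C₁ * x - y)
          (sum-cong (λ i → ℤₚ.*-comm (e i) (d i))) (trans (cong (λ x → Δ * Y * x) (sum-deg (+ a) f f-level)) (lem Δ Y (+ a) X))))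
          where
          lem : ∀ D Y a X → D * Y * (a * X) ≡ a * D * X * Y
          lem = ℤRing.solve-∀
        1* : ∀ x y → (1ℤ * x - Δ) * (1ℤ * y - Δ) ≡ (x - Δ) * (y - Δ)
        1* x y = cong₂ (λ u v → (u - Δ) * (v - Δ)) (ℤₚ.*-identityˡ x) (ℤₚ.*-identityˡ y)
        product-bound : 0ℤ ≤ W * Δ + Δ * ((+ a * X - W) + (+ a * Y - W)) + (+ a * X - W) * (+ a * Y - W) - Σde - 1ℤ
        product-bound = subst (0ℤ ≤_) (trans
          (lem (+ a * X - W) (+ a * Y - W) (sum (λ i → (d i - Δ) * (e i - Δ))) (W * Δ) (Δ * ((+ a * X - W) + (+ a * Y - W))))
          (cong (λ x → W * Δ + Δ * ((+ a * X - W) + (+ a * Y - W)) + (+ a * X - W) * (+ a * Y - W) - x - 1ℤ) (sym Σde≡)))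
          (subst (0ℤ ≤_) (cong₂ (λ x y → x - y - 1ℤ) (cong₂ _*_ (excess f f-level) (excess g g-level)) (sum-cong (λ i → 1* (d i) (e i))))
            (sum-product-strict (λ i → 1ℤ * d i - Δ) (λ i → 1ℤ * e i - Δ) (λ i → ≥1 (df i)) (λ i → ≥1 (dg i))))
          where
          lem : ∀ E F r u v → E * F - r - 1ℤ ≡ u + v + E * F - (u + v + r) - 1ℤ
          lem = ℤRing.solve-∀
          Σde≡ : Σde ≡ W * Δ + Δ * ((+ a * X - W) + (+ a * Y - W)) + sum (λ i → (d i - Δ) * (e i - Δ))
          Σde≡ = trans (sum-shift Δ d e) (cong (_+ sum (λ i → (d i - Δ) * (e i - Δ)))
            (cong₂ (λ x y → x * Δ + Δ * y) (sym W≡) (cong₂ _+_ (cong₂ _-_ (sum-deg (+ a) f f-level) (sym W≡)) (cong₂ _-_ (sum-deg (+ a) g g-level) (sym W≡)))))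

open Cubes

open import Defs
open import Data.Nat using (ℕ; _≤_; _+_; _*_)
open import Data.Nat using (zero; suc; _∸_; _<_; z≤n; s≤s; _≤?_; _<?_)
import Data.Bool
open import Data.Fin.Subset using (_-_)
open import Data.Integer as ℤ using (ℤ; +_; 0ℤ; 1ℤ)
open import Data.List using (List; []; _∷_; length; filter; map)
import Data.List.Membership.DecPropositional as DecMembership
open import Data.List.Membership.Propositional using () renaming (_∈_ to _∈ₗ_; _∉_ to _∉ₗ_)
open import Data.List.Membership.Propositional.Properties using (∈-map⁻; ∈-filter⁻)
open import Data.List.Relation.Unary.All as All using (All; []; _∷_)
open import Data.List.Relation.Unary.AllPairs using ([]; _∷_)
open import Data.List.Relation.Unary.Any using (here; there)
open import Data.List.Relation.Unary.Unique.Propositional using (Unique)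
open import Data.List.Relation.Unary.Unique.Propositional.Properties using (filter⁺)
import Data.Vec.Properties as Vec
open import Relation.Nullary.Decidable using (_×-dec_; _⊎-dec_; ¬?)

-- Indicator functions of families of sets

kron : Subset m → Cube m
kron []            []            = 1ℤ
kron (outside ∷ F) (outside ∷ S) = kron F S
kron (inside ∷ F)  (inside ∷ S)  = kron F S
kron (outside ∷ F) (inside ∷ S)  = 0ℤ
kron (inside ∷ F)  (outside ∷ S) = 0ℤ

kron-refl : (F : Subset m) → kron F F ≡ 1ℤ
kron-refl []            = refl
kron-refl (outside ∷ F) = kron-refl F
kron-refl (inside ∷ F)  = kron-refl F

kron-≢ : (F S : Subset m) → F ≢ S → kron F S ≡ 0ℤ
kron-≢ []            []            ≢ = contradiction refl ≢
kron-≢ (outside ∷ F) (outside ∷ S) ≢ = kron-≢ F S (≢ ∘ cong (outside ∷_))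
kron-≢ (inside ∷ F)  (inside ∷ S)  ≢ = kron-≢ F S (≢ ∘ cong (inside ∷_))
kron-≢ (outside ∷ F) (inside ∷ S)  ≢ = refl
kron-≢ (inside ∷ F)  (outside ∷ S) ≢ = refl

∑-kron : (F : Subset m) → ∑ (kron F) ≡ 1ℤ
∑-kron []            = refl
∑-kron {suc m} (outside ∷ F) = cong₂ ℤ._+_ (∑-kron F) (∑-zero {m} (λ _ → refl))
∑-kron {suc m} (inside ∷ F)  = cong₂ ℤ._+_ (∑-zero {m} (λ _ → refl)) (∑-kron F)

deg-zero : {h : Cube m} → (∀ S → h S ≡ 0ℤ) → ∀ i → deg h i ≡ 0ℤ
deg-zero z zero    = ∑-zero (z ∘ (inside ∷_))
deg-zero z (suc i) = cong₂ ℤ._+_ (deg-zero (z ∘ (outside ∷_)) i) (deg-zero (z ∘ (inside ∷_)) i)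

deg-+ : (h k : Cube m) → ∀ i → deg (λ S → h S ℤ.+ k S) i ≡ deg h i ℤ.+ deg k i
deg-+ h k zero    = ∑-+ (upper h) (upper k)
deg-+ h k (suc i) = trans (cong₂ ℤ._+_ (deg-+ (lower h) (lower k) i) (deg-+ (upper h) (upper k) i))
  (lem (deg (lower h) i) (deg (lower k) i) (deg (upper h) i) (deg (upper k) i))
  where
  lem : ∀ a b c d → (a ℤ.+ b) ℤ.+ (c ℤ.+ d) ≡ (a ℤ.+ c) ℤ.+ (b ℤ.+ d)
  lem = ℤRing.solve-∀

deg-kron-∈ : (F : Subset m) (i : Fin m) → i ∈ F → deg (kron F) i ≡ 1ℤ
deg-kron-∈ (inside ∷ F)  zero    here      = ∑-kron F
deg-kron-∈ (inside ∷ F)  (suc i) (there p) = cong₂ ℤ._+_ (deg-zero (λ _ → refl) i) (deg-kron-∈ F i p)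
deg-kron-∈ (outside ∷ F) (suc i) (there p) = cong₂ ℤ._+_ (deg-kron-∈ F i p) (deg-zero (λ _ → refl) i)

deg-kron-∉ : (F : Subset m) (i : Fin m) → i ∉ F → deg (kron F) i ≡ 0ℤ
deg-kron-∉ (inside ∷ F)  zero    ∉ = contradiction here ∉
deg-kron-∉ {suc m} (outside ∷ F) zero ∉ = ∑-zero {m} (λ _ → refl)
deg-kron-∉ (inside ∷ F)  (suc i) ∉ = cong₂ ℤ._+_ (deg-zero (λ _ → refl) i) (deg-kron-∉ F i (∉ ∘ there))
deg-kron-∉ (outside ∷ F) (suc i) ∉ = cong₂ ℤ._+_ (deg-kron-∉ F i (∉ ∘ there)) (deg-zero (λ _ → refl) i)

-- Built as a sum over the list, so that degrees are additive by construction; freedom from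
-- repetition is what makes the values 0 and 1.
indicator : List (Subset m) → Cube m
indicator []      S = 0ℤ
indicator (F ∷ L) S = kron F S ℤ.+ indicator L S

degree : List (Subset m) → Fin m → ℕ
degree L i = length (filter (i ∈?_) L)

deg-indicator : (L : List (Subset m)) (i : Fin m) → deg (indicator L) i ≡ + degree L i
deg-indicator []      i = deg-zero (λ _ → refl) i
deg-indicator (F ∷ L) i = trans (deg-+ (kron F) (indicator L) i) step
  where
  step : deg (kron F) i ℤ.+ deg (indicator L) i ≡ + degree (F ∷ L) i
  step with i ∈? F
  ... | yes p = cong₂ ℤ._+_ (deg-kron-∈ F i p) (deg-indicator L i)
  ... | no ∉  = trans (cong₂ ℤ._+_ (deg-kron-∉ F i ∉) (deg-indicator L i)) (ℤₚ.+-identityˡ (+ degree L i))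

_≟ₛ_ : (F S : Subset m) → Dec (F ≡ S)
_≟ₛ_ = Vec.≡-dec Data.Bool._≟_

indicator-∉ : (L : List (Subset m)) (S : Subset m) → S ∉ₗ L → indicator L S ≡ 0ℤ
indicator-∉ []      S ∉ = refl
indicator-∉ (F ∷ L) S ∉ = cong₂ ℤ._+_ (kron-≢ F S (∉ ∘ here ∘ sym)) (indicator-∉ L S (∉ ∘ there))

indicator-∈ : {L : List (Subset m)} {S : Subset m} → Unique L → S ∈ₗ L → indicator L S ≡ 1ℤ
indicator-∈ {L = F ∷ L} (F∉L ∷ u) (here refl) =
  cong₂ ℤ._+_ (kron-refl F) (indicator-∉ L F λ F∈L → All.lookup F∉L F∈L refl)
indicator-∈ {L = F ∷ L} {S} (F∉L ∷ u) (there S∈L) = cong₂ ℤ._+_ (kron-≢ F S (All.lookup F∉L S∈L)) (indicator-∈ u S∈L)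

_∈ₗ?_ : (S : Subset m) (L : List (Subset m)) → Dec (S ∈ₗ L)
_∈ₗ?_ = DecMembership._∈?_ _≟ₛ_

module _ {L : List (Subset m)} (unique : Unique L) where

  indicator-idem : ∀ S → indicator L S ℤ.* indicator L S ≡ indicator L S
  indicator-idem S with S ∈ₗ? L
  ... | yes p = trans (cong₂ ℤ._*_ e e) (sym e) where e = indicator-∈ unique p
  ... | no ∉  = trans (cong₂ ℤ._*_ e e) (sym e) where e = indicator-∉ L S ∉

  indicator-level : ∀ a → (∀ {F} → F ∈ₗ L → ∣ F ∣ ≡ a) → IsLevel (+ a) (indicator L)
  indicator-level a size≡ S with S ∈ₗ? L
  ... | yes p = cong (λ s → + s ℤ.* indicator L S) (size≡ p)
  ... | no ∉  = trans (cong (λ x → size S ℤ.* x) e) (trans (ℤₚ.*-zeroʳ (size S))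
                  (sym (trans (cong (λ x → + a ℤ.* x) e) (ℤₚ.*-zeroʳ (+ a))))) where e = indicator-∉ L S ∉

indicator-cross : (L₁ L₂ : List (Subset m)) → (∀ {A B} → A ∈ₗ L₁ → B ∈ₗ L₂ → Nonempty (A ∩ B)) →
  ⟪ indicator L₁ , K (indicator L₂) ⟫ ≡ 0ℤ
indicator-cross L₁ L₂ cross = ∑-zero pt
  where
  pt : ∀ S → indicator L₁ S ℤ.* K (indicator L₂) S ≡ 0ℤ
  pt S with S ∈ₗ? L₁
  ... | no ∉  = trans (cong (ℤ._* K (indicator L₂) S) (indicator-∉ L₁ S ∉)) (ℤₚ.*-zeroˡ (K (indicator L₂) S))
  ... | yes p = trans (cong (λ x → indicator L₁ S ℤ.* x) (K-vanish (indicator L₂) S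
      λ B empty → indicator-∉ L₂ B λ B∈ → empty (cross p B∈))) (ℤₚ.*-zeroʳ (indicator L₁ S))

degree-witness : (L : List (Subset m)) (i : Fin m) → 0 < degree L i → ∃[ F ] (F ∈ₗ L × i ∈ F)
degree-witness (F ∷ L) i p with i ∈? F
... | yes i∈F = F , here refl , i∈F
... | no  _ with degree-witness L i p
...   | G , G∈L , i∈G = G , there G∈L , i∈G

∈-unique : {p : Subset m} {x y : Fin m} → ∣ p ∣ ≤ 1 → x ∈ p → y ∈ p → x ≡ y
∈-unique {p = p} {x} {y} small x∈p y∈p with x ≟ y
... | yes e = e
... | no x≢y = contradiction (ℕₚ.≤-trans (s≤s (ℕₚ.≤-trans (s≤s z≤n) (x∈p⇒∣p-x∣<∣p∣ (x∈p∧x≢y⇒x∈p-y y∈p (x≢y ∘ sym))))) (ℕₚ.≤-trans (x∈p⇒∣p-x∣<∣p∣ x∈p) small)) λ { (s≤s ()) }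

large-degree : (L : List (Subset m)) (i : Fin m) {D : ℕ} → ¬ (degree L i ≤ D) → 1ℤ ℤ.+ + D ℤ.≤ deg (indicator L) i
large-degree L i {D} p = subst (+ suc D ℤ.≤_) (sym (deg-indicator L i)) (ℤ.+≤+ (ℕₚ.≰⇒> p))

-- A degree version of the Erdős–Ko–Rado theorem for cross-intersecting families; L₁ = L₂ is the Huang–Zhao theorem.
min-degree : ∀ {m} (a : ℕ) {L₁ L₂ : List (Subset m)} (unique₁ : Unique L₁) (unique₂ : Unique L₂)
  (size₁ : ∀ {F} → F ∈ₗ L₁ → ∣ F ∣ ≡ a) (size₂ : ∀ {F} → F ∈ₗ L₂ → ∣ F ∣ ≡ a)
  (cross : ∀ {A B} → A ∈ₗ L₁ → B ∈ₗ L₂ → Nonempty (A ∩ B)) →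
  2 * a + 1 ≤ m → ∃[ i ] (degree L₁ i ≤ binomSub m 2 a 2 ⊎ degree L₂ i ≤ binomSub m 2 a 2)
-- The bound is zero by the convention for a negative lower index, and the only possible member is
-- the empty set.
min-degree zero {L₁} _ _ size₁ _ _ (s≤s _) = zero , inj₁ (ℕₚ.≮⇒≥ λ pos →
  let F , F∈L₁ , 0∈F = degree-witness L₁ zero pos in
  ℕₚ.n≮0 (subst (∣ F - zero ∣ <_) (size₁ F∈L₁) (x∈p⇒∣p-x∣<∣p∣ 0∈F)))
-- The bound is zero again. If both tested degrees were positive, the two families would contain the
-- disjoint singletons of the points 0 and 1.
min-degree (suc zero) {L₁} {L₂} _ _ size₁ size₂ cross (s≤s (s≤s _))
  with 0 <? degree L₁ zero | 0 <? degree L₂ (suc zero)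
... | no ≮ | _    = zero , inj₁ (ℕₚ.≮⇒≥ ≮)
... | _    | no ≮ = suc zero , inj₂ (ℕₚ.≮⇒≥ ≮)
... | yes p | yes q with degree-witness L₁ zero p | degree-witness L₂ (suc zero) q
...   | A , A∈ , 0∈A | B , B∈ , 1∈B with cross A∈ B∈
...     | x , x∈ with x∈p∩q⁻ A B x∈
...       | x∈A , x∈B with trans (∈-unique (ℕₚ.≤-reflexive (size₁ A∈)) 0∈A x∈A) (∈-unique (ℕₚ.≤-reflexive (size₂ B∈)) x∈B 1∈B)
...         | ()
min-degree {m} (suc (suc α)) {L₁} {L₂} unique₁ unique₂ size₁ size₂ cross m≥ = go (α + (suc q + α) + 2) refl m≡
  where
  q = m ∸ (2 * suc (suc α) + 1)
  m≡ : m ≡ suc (suc (α + (suc q + α) + 2))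
  m≡ = trans (sym (ℕₚ.m+[n∸m]≡n m≥)) (lem α q)
    where
    lem : ∀ α q → 2 * suc (suc α) + 1 + q ≡ suc (suc (α + (suc q + α) + 2))
    lem = ℕRing.solve-∀
  go : ∀ n → n ≡ α + (suc q + α) + 2 → m ≡ suc (suc n) →
    ∃[ i ] (degree L₁ i ≤ (m ∸ 2) C α ⊎ degree L₂ i ≤ (m ∸ 2) C α)
  go n n≡ refl with any? (λ i → (degree L₁ i ≤? n C α) ⊎-dec (degree L₂ i ≤? n C α))
  ... | yes found = found
  ... | no none = ⊥-elim (Spectrum.Pair.no-large-degrees α q n n≡ (indicator L₁) (indicator L₂)
          (indicator-level unique₁ (suc (suc α)) size₁) (indicator-level unique₂ (suc (suc α)) size₂)
          (indicator-idem unique₁) (indicator-idem unique₂) (indicator-cross L₁ L₂ cross)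
          (λ i → large-degree L₁ i (λ p → none (i , inj₁ p))) (λ i → large-degree L₂ i (λ p → none (i , inj₂ p))))

-- Traces on the complement of the transversal, relabelled as `Fin ∣ ∁ T ∣`

restrict : (T : Subset n) → Subset n → Subset ∣ ∁ T ∣
restrict []            []      = []
restrict (inside ∷ T)  (_ ∷ F) = restrict T F
restrict (outside ∷ T) (s ∷ F) = s ∷ restrict T F

embed : (T : Subset n) → Fin ∣ ∁ T ∣ → Fin n
embed (inside ∷ T)  i       = suc (embed T i)
embed (outside ∷ T) zero    = zero
embed (outside ∷ T) (suc i) = suc (embed T i)

embed-∉ : (T : Subset n) (i : Fin ∣ ∁ T ∣) → embed T i ∉ T
embed-∉ (inside ∷ T)  i       (there p) = embed-∉ T i p
embed-∉ (outside ∷ T) (suc i) (there p) = embed-∉ T i p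

restrict⁺ : (T F : Subset n) (i : Fin ∣ ∁ T ∣) → embed T i ∈ F → i ∈ restrict T F
restrict⁺ (inside ∷ T)  (_ ∷ F) i       (there p) = restrict⁺ T F i p
restrict⁺ (outside ∷ T) (_ ∷ F) zero    here      = here
restrict⁺ (outside ∷ T) (_ ∷ F) (suc i) (there p) = there (restrict⁺ T F i p)

restrict⁻ : (T F : Subset n) (i : Fin ∣ ∁ T ∣) → i ∈ restrict T F → embed T i ∈ F
restrict⁻ (inside ∷ T)  (_ ∷ F) i       p         = there (restrict⁻ T F i p)
restrict⁻ (outside ∷ T) (_ ∷ F) zero    here      = here
restrict⁻ (outside ∷ T) (_ ∷ F) (suc i) (there p) = there (restrict⁻ T F i p)

restrict-∩ : (T F G : Subset n) → restrict T (F ∩ G) ≡ restrict T F ∩ restrict T G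
restrict-∩ []            []      []      = refl
restrict-∩ (inside ∷ T)  (_ ∷ F) (_ ∷ G) = restrict-∩ T F G
restrict-∩ (outside ∷ T) (_ ∷ F) (_ ∷ G) = cong (_ ∷_) (restrict-∩ T F G)

restrict-size : (T F : Subset n) → ∣ T ∩ F ∣ + ∣ restrict T F ∣ ≡ ∣ F ∣
restrict-size []            []            = refl
restrict-size (inside ∷ T)  (inside ∷ F)  = cong suc (restrict-size T F)
restrict-size (inside ∷ T)  (outside ∷ F) = restrict-size T F
restrict-size (outside ∷ T) (inside ∷ F)  = trans (ℕₚ.+-suc ∣ T ∩ F ∣ ∣ restrict T F ∣) (cong suc (restrict-size T F))
restrict-size (outside ∷ T) (outside ∷ F) = restrict-size T F

restrict-injective : (T F G : Subset n) → T ∩ F ≡ T ∩ G → restrict T F ≡ restrict T G → F ≡ G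
restrict-injective []            []      []      _ _ = refl
restrict-injective (inside ∷ T)  (_ ∷ F) (_ ∷ G) e f =
  cong₂ _∷_ (Vec.∷-injectiveˡ e) (restrict-injective T F G (Vec.∷-injectiveʳ e) f)
restrict-injective (outside ∷ T) (_ ∷ F) (_ ∷ G) e f =
  cong₂ _∷_ (Vec.∷-injectiveˡ f) (restrict-injective T F G (Vec.∷-injectiveʳ e) (Vec.∷-injectiveʳ f))

⊆∧≥⇒≡ : {p q : Subset n} → p ⊆ q → ∣ q ∣ ≤ ∣ p ∣ → p ≡ q
⊆∧≥⇒≡ {p = p} {q} p⊆q q≤p = ⊆-antisym p⊆q q⊆p
  where
  q⊆p : q ⊆ p
  q⊆p {z} z∈q with z ∈? p
  ... | yes z∈p = z∈p
  ... | no z∉p  = contradiction q≤p (ℕₚ.<⇒≱ (p⊂q⇒∣p∣<∣q∣ (p⊆q , z , z∈q , z∉p)))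

element : (p : Subset n) → 1 ≤ ∣ p ∣ → Nonempty p
element (inside ∷ p)  _ = zero , here
element (outside ∷ p) s with element p s
... | x , x∈p = suc x , there x∈p

two-elements : (p : Subset n) → 2 ≤ ∣ p ∣ → ∃[ x ] ∃[ y ] (x ∈ p × y ∈ p × x ≢ y)
two-elements (inside ∷ p)  (s≤s s) with element p s
... | y , y∈p = zero , suc y , here , there y∈p , λ ()
two-elements (outside ∷ p) s with two-elements p s
... | x , y , x∈p , y∈p , x≢y = suc x , suc y , there x∈p , there y∈p , λ { refl → x≢y refl }

map-unique : {A B : Set} (f : A → B) {L : List A} → (∀ {x y} → x ∈ₗ L → y ∈ₗ L → f x ≡ f y → x ≡ y) →
  Unique L → Unique (map f L)
map-unique f inj []      = []
map-unique {A} {B} f {x ∷ L} inj (x∉ ∷ u) = fresh L there x∉ ∷ map-unique f (λ p q → inj (there p) (there q)) u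
  where
  fresh : ∀ L′ → (∀ {y} → y ∈ₗ L′ → y ∈ₗ x ∷ L) → All (x ≢_) L′ → All (f x ≢_) (map f L′)
  fresh []       sub []         = []
  fresh (y ∷ L′) sub (x≢y ∷ x≢) = (λ e → x≢y (inj (here refl) (sub (here refl)) e)) ∷ fresh L′ (sub ∘ there) x≢

-- Both sides take the same branch, as `t + 2 ≤ a + t` is equivalent to `2 ≤ a`. With
-- `m = n - t - 1` and `a = k - t`, this matches the bound on the traces to the one for the family.
binomSub-shift : ∀ m a t → binomSub (m + (t + 1)) (t + 3) (a + t) (t + 2) ≡ binomSub m 2 a 2
binomSub-shift m a t with t + 2 ≤? a + t | 2 ≤? a
... | yes _ | yes _ = cong₂ _C_ (trans (cong₂ _∸_ (lem₁ m t) (lem₂ t)) (ℕₚ.[m+n]∸[m+o]≡n∸o (t + 1) m 2))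
                        (trans (cong (_∸ (t + 2)) (ℕₚ.+-comm a t)) (ℕₚ.[m+n]∸[m+o]≡n∸o t a 2))
  where
  lem₁ : ∀ m t → m + (t + 1) ≡ t + 1 + m
  lem₁ = ℕRing.solve-∀
  lem₂ : ∀ t → t + 3 ≡ t + 1 + 2
  lem₂ = ℕRing.solve-∀
... | no ≰  | no _  = refl
... | yes le | no ¬le  = contradiction (ℕₚ.+-cancelˡ-≤ t 2 a (ℕₚ.≤-trans le (ℕₚ.≤-reflexive (ℕₚ.+-comm a t)))) ¬le
... | no ¬le  | yes le = contradiction (ℕₚ.≤-trans (ℕₚ.+-monoʳ-≤ t le) (ℕₚ.≤-reflexive (ℕₚ.+-comm t a))) ¬le

trace : (T : Subset n) (x : Fin n) → List (Subset n) → List (Subset ∣ ∁ T ∣)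
trace T x M = map (restrict T) (filter (λ F → ¬? (x ∈? F)) M)

-- The right-hand side is `b` unfolded over an arbitrary list, which lets the induction run.
degree-trace : (T : Subset n) (x : Fin n) (i : Fin ∣ ∁ T ∣) (M : List (Subset n)) →
  degree (trace T x M) i ≡ length (filter (λ F → (embed T i ∈? F) ×-dec ¬? (x ∈? F)) M)
degree-trace T x i []      = refl
degree-trace T x i (F ∷ M) with x ∈? F | embed T i ∈? F
... | yes _ | yes _  = degree-trace T x i M
... | yes _ | no _   = degree-trace T x i M
... | no _  | i∈F?   with i ∈? restrict T F | i∈F?
...   | yes _ | yes _  = cong suc (degree-trace T x i M)
...   | no _  | no _   = degree-trace T x i M
...   | yes p | no ∉   = contradiction (restrict⁻ T F i p) ∉
...   | no ∉  | yes p  = contradiction (restrict⁺ T F i p) ∉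

module Transversal {n k t : ℕ} (𝓕 : Family n) (uniform : Uniform k 𝓕) (intersecting : TIntersecting t 𝓕)
                   (T : Subset n) (transversal : IsTTransversal t 𝓕 T) (∣T∣≡ : ∣ T ∣ ≡ t + 1) where

  module _ {x : Fin n} (x∈T : x ∈ T) where

    ∣T-x∣≤t : ∣ T - x ∣ ≤ t
    ∣T-x∣≤t = ℕₚ.≤-pred (ℕₚ.≤-trans (x∈p⇒∣p-x∣<∣p∣ x∈T) (ℕₚ.≤-reflexive (trans ∣T∣≡ (ℕₚ.+-comm t 1))))

    -- `T ∩ F` is contained in `T - x`, which has at most `t` elements, while a transversal meets
    -- `F` in at least `t`.
    missing : ∀ {F} → F ∈ₗ members 𝓕 → x ∉ F → T ∩ F ≡ T - x
    missing {F} F∈ x∉F = ⊆∧≥⇒≡ sub (ℕₚ.≤-trans ∣T-x∣≤t (transversal F∈))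
      where
      sub : T ∩ F ⊆ T - x
      sub z∈ with x∈p∩q⁻ T F z∈
      ... | z∈T , z∈F = x∈p∧x≢y⇒x∈p-y z∈T λ { refl → x∉F z∈F }

    private
      L = filter (λ F → ¬? (x ∈? F)) (members 𝓕)

      split : ∀ {F} → F ∈ₗ L → F ∈ₗ members 𝓕 × x ∉ F
      split = ∈-filter⁻ (λ F → ¬? (x ∈? F))

    -- All these members have the same part `T - x` inside `T`, so they are told apart outside it.
    trace-unique : Unique (trace T x (members 𝓕))
    trace-unique = map-unique (restrict T) (λ F∈ G∈ e → restrict-injective T _ _
      (trans (missing (proj₁ (split F∈)) (proj₂ (split F∈))) (sym (missing (proj₁ (split G∈)) (proj₂ (split G∈))))) e)
      (filter⁺ (λ F → ¬? (x ∈? F)) (distinct 𝓕))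

    trace-size : ∀ {A} → A ∈ₗ trace T x (members 𝓕) → ∣ A ∣ ≡ k ∸ t
    trace-size A∈ with ∈-map⁻ (restrict T) A∈
    ... | F , F∈L , refl with split F∈L
    ...   | F∈ , x∉F = trans (sym (ℕₚ.m+n∸m≡n ∣ T ∩ F ∣ ∣ restrict T F ∣))
            (cong₂ _∸_ (trans (restrict-size T F) (uniform F∈)) ∣T∩F∣≡t)
      where
      ∣T∩F∣≡t : ∣ T ∩ F ∣ ≡ t
      ∣T∩F∣≡t = ℕₚ.≤-antisym (ℕₚ.≤-trans (ℕₚ.≤-reflexive (cong ∣_∣ (missing F∈ x∉F))) ∣T-x∣≤t) (transversal F∈)

    trace-preimage : ∀ {A} → A ∈ₗ trace T x (members 𝓕) → ∃[ F ] (F ∈ₗ members 𝓕 × x ∉ F × A ≡ restrict T F)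
    trace-preimage A∈ with ∈-map⁻ (restrict T) A∈
    ... | F , F∈L , e = F , proj₁ (split F∈L) , proj₂ (split F∈L) , e

  -- If `F` and `G` had no common point outside `T`, then `F ∩ G` would lie in `T - x - y`, which
  -- has fewer than `t` elements.
  trace-cross : ∀ {x y} → x ∈ T → y ∈ T → x ≢ y → ∀ {A B} →
    A ∈ₗ trace T x (members 𝓕) → B ∈ₗ trace T y (members 𝓕) → Nonempty (A ∩ B)
  trace-cross {x} {y} x∈T y∈T x≢y {A} {B} A∈ B∈ with trace-preimage x∈T A∈ | trace-preimage y∈T B∈
  ... | F , F∈ , x∉F , refl | G , G∈ , y∉G , refl with nonempty? (restrict T F ∩ restrict T G)
  ...   | yes meet = meet
  ...   | no empty = contradiction (ℕₚ.≤-trans (intersecting F∈ G∈) (ℕₚ.≤-reflexive ∣F∩G∣≡)) (ℕₚ.<⇒≱ small)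
    where
    ∣F∩G∣≡ : ∣ F ∩ G ∣ ≡ ∣ T ∩ (F ∩ G) ∣
    ∣F∩G∣≡ = trans (sym (restrict-size T (F ∩ G))) (trans (cong (λ s → ∣ T ∩ (F ∩ G) ∣ + s)
      (trans (cong ∣_∣ (trans (restrict-∩ T F G) (Empty-unique empty))) (∣⊥∣≡0 ∣ ∁ T ∣))) (ℕₚ.+-identityʳ _))
    sub : T ∩ (F ∩ G) ⊆ T - x - y
    sub z∈ with x∈p∩q⁻ T (F ∩ G) z∈
    ... | z∈T , z∈FG with x∈p∩q⁻ F G z∈FG
    ...   | z∈F , z∈G = x∈p∧x≢y⇒x∈p-y (x∈p∧x≢y⇒x∈p-y z∈T λ { refl → x∉F z∈F }) λ { refl → y∉G z∈G }
    small : ∣ T ∩ (F ∩ G) ∣ < t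
    small = ℕₚ.≤-trans (s≤s (p⊆q⇒∣p∣≤∣q∣ sub))
      (ℕₚ.≤-trans (x∈p⇒∣p-x∣<∣p∣ (x∈p∧x≢y⇒x∈p-y y∈T (x≢y ∘ sym))) (∣T-x∣≤t x∈T))

theorem4p2 : (n k t : ℕ) (𝓕 : Family n) →
    Uniform k 𝓕 → TIntersecting t 𝓕 →
    TauIs t 𝓕 (t + 1) →
    2 * k + 2 ≤ n + t →
    SturdinessAtMost 𝓕 (binomSub n (t + 3) k (t + 2))
theorem4p2 n k t 𝓕 uniform intersecting ((T , transversal , ∣T∣≡) , minimal) n≥ = conclude pair
  where
  open Transversal 𝓕 uniform intersecting T transversal ∣T∣≡
  a = k ∸ t
  r = ∣ ∁ T ∣

  -- Minimality would force `t + 1 ≤ 0`. This excludes both `t = 0` and an empty family, since in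
  -- either case the empty set would be a transversal.
  not-transversal : ¬ IsTTransversal t 𝓕 ∅
  not-transversal tr = ℕₚ.n≮0 (subst₂ _≤_ (ℕₚ.+-comm t 1) (∣⊥∣≡0 n) (minimal ∅ tr))

  t≥1 : ∀ t′ → t′ ≡ t → 1 ≤ t′
  t≥1 zero    refl = ⊥-elim (not-transversal λ _ → z≤n)
  t≥1 (suc _) _    = s≤s z≤n

  t≤k : t ≤ k
  t≤k = go (members 𝓕) refl
    where
    go : ∀ M → M ≡ members 𝓕 → t ≤ k
    go []      e = ⊥-elim (not-transversal λ {F} F∈ → contradiction (subst (F ∈ₗ_) (sym e) F∈) λ ())
    go (F ∷ M) e = let F∈ = subst (F ∈ₗ_) e (here refl) in
      ℕₚ.≤-trans (transversal F∈) (ℕₚ.≤-trans (∣p∩q∣≤∣q∣ T F) (ℕₚ.≤-reflexive (uniform F∈)))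

  k≡ : k ≡ a + t
  k≡ = sym (ℕₚ.m∸n+n≡m t≤k)

  n≡ : n ≡ r + (t + 1)
  n≡ = sym (trans (cong (_+ (t + 1)) (trans (∣∁p∣≡n∸∣p∣ T) (cong (n ∸_) ∣T∣≡)))
    (ℕₚ.m∸n+n≡m (ℕₚ.≤-trans (ℕₚ.≤-reflexive (sym ∣T∣≡)) (∣p∣≤n T))))

  -- With `k = a + t` and `n = r + (t + 1)` the hypothesis reads
  -- `2 * a + 2 * t + 2 ≤ r + 2 * t + 1`.
  m≥ : 2 * a + 1 ≤ r
  m≥ = ℕₚ.+-cancelʳ-≤ (2 * t + 1) (2 * a + 1) r (subst₂ _≤_
    (trans (cong (λ x → 2 * x + 2) k≡) (lem₁ a t)) (trans (cong (_+ t) n≡) (lem₂ r t)) n≥)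
    where
    lem₁ : ∀ a t → 2 * (a + t) + 2 ≡ 2 * a + 1 + (2 * t + 1)
    lem₁ = ℕRing.solve-∀
    lem₂ : ∀ r t → r + (t + 1) + t ≡ r + (2 * t + 1)
    lem₂ = ℕRing.solve-∀

  bound≡ : binomSub r 2 a 2 ≡ binomSub n (t + 3) k (t + 2)
  bound≡ = trans (sym (binomSub-shift r a t)) (sym (cong₂ (λ n k → binomSub n (t + 3) k (t + 2)) n≡ k≡))

  pair : ∃[ x ] ∃[ y ] (x ∈ T × y ∈ T × x ≢ y)
  pair = two-elements T (subst (2 ≤_) (sym ∣T∣≡) (ℕₚ.+-monoˡ-≤ 1 (t≥1 t refl)))

  -- The pair witnessing the sturdiness is `embed T i` and `x`; the points differ because one lies
  -- outside `T` and the other inside.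
  transfer : ∀ {x} → x ∈ T → ∀ i → degree (trace T x (members 𝓕)) i ≤ binomSub r 2 a 2 →
    SturdinessAtMost 𝓕 (binomSub n (t + 3) k (t + 2))
  transfer {x} x∈T i d≤ = embed T i , x , (λ { refl → embed-∉ T i x∈T }) ,
    subst₂ _≤_ (degree-trace T x i (members 𝓕)) bound≡ d≤

  conclude : ∃[ x ] ∃[ y ] (x ∈ T × y ∈ T × x ≢ y) → SturdinessAtMost 𝓕 (binomSub n (t + 3) k (t + 2))
  conclude (x , y , x∈T , y∈T , x≢y) with min-degree a (trace-unique x∈T) (trace-unique y∈T)
    (trace-size x∈T) (trace-size y∈T) (trace-cross x∈T y∈T x≢y) m≥
  ... | i , inj₁ d≤ = transfer x∈T i d≤
  ... | i , inj₂ d≤ = transfer y∈T i d≤
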